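{- Let $n\ge 2$ and let $\pi,\sigma\in\mathfrak{B}_n$ be selected independently and uniformly at random. Let $p_{n,2}=\mathbb{P}(\pi\text{ and }\sigma\text{ are comparable})$ and $p_{n,2,\le}=\mathbb{P}(\pi\le\sigma)$, with respect to Bruhat order. Then $$p_{n,2}=\frac{\mathfrak{b}_{n+2}-5}{5\,\mathfrak{b}_n}\qquad\text{and}\qquad p_{n,2,\le}=\frac{\mathfrak{b}_{n+2}}{10\,\mathfrak{b}_n}.$$
   Context: $\mathfrak{S}_n$ is the set of permutations of $[n]=\{1,\dots,n\}$, in one-line notation. A reduction of $\omega\in\mathfrak{S}_n$ interchanges $\omega(i)$ and $\omega(j)$ for some $i<j$ with $\omega(i)>\omega(j)$. Bruhat order: $\pi\le\sigma$ if $\pi$ is obtained from $\sigma$ by a (possibly empty) sequence of reductions. $\mathfrak{B}_n\subseteq\mathfrak{S}_n$ is the set of bigrassmannian permutations, i.e. those $\omega$ such that both $\omega$ and $\omega^{ -1}$ have exactly one descent; equivalently $\omega=1\cdots a\,(b+1)\cdots c\,(a+1)\cdots b\,(c+1)\cdots n$ for some $0\le a<b<c\le n$. $\mathfrak{b}_n=|\mathfrak{B}_n|=\binom{n+1}{3}$. $\pi,\sigma$ are comparable if $\pi\le\sigma$ or $\sigma\le\pi$. -}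

module Defs where

open import Data.Empty using (⊥-elim)
open import Data.Fin.Base using (Fin; zero; suc; toℕ; _<_; punchIn)
open import Data.Fin.Induction using (<-wellFounded)
open import Data.Fin.Permutation
  using (Permutation′; _⟨$⟩ʳ_; _⟨$⟩ˡ_; _≈_; _∘ₚ_; id; flip; transpose; swap; insert; remove;
         insert-punchIn; insert-remove; inverseˡ; inverseʳ)
open import Data.Fin.Properties
  using (_≟_; _<?_; any?; all?; <⇒≢; <-trans; punchInᵢ≢i; punchIn-punchOut; punchIn-injective)
open import Data.Integer.Base using (+_)
open import Data.List.Base using (List; []; _∷_; length; filter; cartesianProduct; cartesianProductWith; allFin)
import Data.List.Membership.Setoid as Membership
import Data.List.Membership.Setoid.Properties as Membershipₚ
import Data.List.Membership.Propositional.Properties as Membership-≡ₚ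
open import Data.List.Relation.Unary.Any using (here; there)
open import Data.List.Relation.Unary.All using ([])
open import Data.List.Relation.Unary.AllPairs using ([]; _∷_)
import Data.List.Relation.Unary.Unique.Setoid as UniqueSetoid
import Data.List.Relation.Unary.Unique.Setoid.Properties as Uniqueₚ
open import Data.List.Relation.Unary.Unique.Propositional.Properties using (allFin⁺)
open import Data.Nat.Base using (ℕ; zero; suc; _*_; NonZero; NonTrivial; z≤n; s≤s; s≤s⁻¹)
import Data.Nat.Properties as ℕ
open import Data.Product using (∃; ∃!; ∃₂; _×_; _,_; proj₁; proj₂; uncurry)
open import Data.Rational.Base using (ℚ; _/_)
open import Data.Sum.Base using (_⊎_; inj₁; inj₂)
open import Data.Vec.Base using (Vec; tabulate)
import Data.Vec.Relation.Binary.Lex.Strict as Lex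
open import Function.Base using (_on_; _∘_; it)
open import Induction.WellFounded using (WellFounded; Acc; acc)
open import Level using (Level; 0ℓ)
open import Relation.Binary.Bundles using (Setoid)
open import Relation.Binary.Core using (Rel)
import Relation.Binary.Construct.On as On
open import Relation.Binary.PropositionalEquality
  using (_≡_; _≢_; refl; sym; trans; cong; subst; subst₂; setoid)
open import Relation.Nullary using (Dec; yes; no)
open import Relation.Nullary.Decidable using (map′; _×-dec_; _⊎-dec_; _→-dec_; dec-true; dec-false)
open import Relation.Unary using (Pred; Decidable)

private
  variable
    a p : Level
    n : ℕ

-- Propositional equality of `Permutation′ n`
-- is too fine without function extensionality, so permutations are
-- compared by _≈_ throughout.
𝔖-setoid : ℕ → Setoid 0ℓ 0ℓ
𝔖-setoid n = record
  { Carrier       = Permutation′ n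
  ; _≈_           = _≈_
  ; isEquivalence = record
    { refl  = λ _ → refl
    ; sym   = λ π≈ρ i → sym (π≈ρ i)
    ; trans = λ π≈ρ ρ≈σ i → trans (π≈ρ i) (ρ≈σ i)
    }
  }

_≈?_ : (π ρ : Permutation′ n) → Dec (π ≈ ρ)
π ≈? ρ = all? λ i → (π ⟨$⟩ʳ i) ≟ (ρ ⟨$⟩ʳ i)

-- `insert zero i π` has first letter i, and its remaining letters are
-- those of π relabelled to avoid i.  So each permutation is listed
-- exactly once, up to _≈_ (see 𝔖-complete and 𝔖-unique).
𝔖 : (n : ℕ) → List (Permutation′ n)
𝔖 zero    = id ∷ []
𝔖 (suc n) = cartesianProductWith (insert zero) (allFin (suc n)) (𝔖 n)

module _ {n : ℕ} where
  open Membership (𝔖-setoid n) using () renaming (_∈_ to _∈≈_) public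
  open UniqueSetoid (𝔖-setoid n) using () renaming (Unique to Unique≈) public

private
  insert-suc : ∀ i (π : Permutation′ n) k →
               insert zero i π ⟨$⟩ʳ suc k ≡ punchIn i (π ⟨$⟩ʳ k)
  insert-suc i π k = insert-punchIn zero i π k

  insert-cong : ∀ {i j} {π ρ : Permutation′ n} →
                i ≡ j → π ≈ ρ → insert zero i π ≈ insert zero j ρ
  insert-cong refl π≈ρ zero = refl
  insert-cong {i = i} {π = π} {ρ} refl π≈ρ (suc k) =
    trans (insert-suc i π k) (trans (cong (punchIn i) (π≈ρ k)) (sym (insert-suc i ρ k)))

  insert-injective : ∀ {i j} {π ρ : Permutation′ n} →
                     insert zero i π ≈ insert zero j ρ → i ≡ j × π ≈ ρ
  insert-injective {i = i} {π = π} {ρ} eq with eq zero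
  ... | refl = refl , λ k → punchIn-injective i _ _
    (trans (sym (insert-suc i π k)) (trans (eq (suc k)) (insert-suc i ρ k)))

𝔖-complete : (π : Permutation′ n) → π ∈≈ 𝔖 n
𝔖-complete {zero}  π = here λ ()
𝔖-complete {suc n} π = Membershipₚ.∈-resp-≈ (𝔖-setoid (suc n))
  {x = insert zero (π ⟨$⟩ʳ zero) (remove zero π)} {π} (insert-remove zero π)
  (Membershipₚ.∈-cartesianProductWith⁺ (setoid _) (𝔖-setoid n) (𝔖-setoid (suc n))
    (λ {i} {j} {π} {ρ} → insert-cong {i = i} {j} {π} {ρ})
    (Membership-≡ₚ.∈-allFin (π ⟨$⟩ʳ zero))
    (𝔖-complete (remove zero π)))

𝔖-unique : (n : ℕ) → Unique≈ (𝔖 n)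
𝔖-unique zero    = [] ∷ []
𝔖-unique (suc n) = Uniqueₚ.cartesianProductWith⁺
  (setoid _) (𝔖-setoid n) (𝔖-setoid (suc n)) (insert zero)
  (λ {i} {j} {π} {ρ} → insert-injective {i = i} {j} {π} {ρ})
  (allFin⁺ (suc n)) (𝔖-unique n)

Descent : Permutation′ n → Fin n → Set
Descent π i = ∃ λ j → toℕ j ≡ suc (toℕ i) × π ⟨$⟩ʳ j < π ⟨$⟩ʳ i

HasUniqueDescent : Permutation′ n → Set
HasUniqueDescent π = ∃! _≡_ (Descent π)

Bigrassmannian : Permutation′ n → Set
Bigrassmannian π = HasUniqueDescent π × HasUniqueDescent (flip π)

descent? : (π : Permutation′ n) → Decidable (Descent π)
descent? π i = any? λ j → (toℕ j ℕ.≟ suc (toℕ i)) ×-dec ((π ⟨$⟩ʳ j) <? (π ⟨$⟩ʳ i))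

hasUniqueDescent? : Decidable (HasUniqueDescent {n})
hasUniqueDescent? π =
  map′ (λ (i , d , u) → i , d , λ {j} → u j)
       (λ (i , d , u) → i , d , λ j → u {j})
       (any? λ i → descent? π i ×-dec all? λ j → descent? π j →-dec (i ≟ j))

bigrassmannian? : Decidable (Bigrassmannian {n})
bigrassmannian? π = hasUniqueDescent? π ×-dec hasUniqueDescent? (flip π)

𝔅 : (n : ℕ) → List (Permutation′ n)
𝔅 n = filter bigrassmannian? (𝔖 n)

𝔟 : ℕ → ℕ
𝔟 n = length (𝔅 n)

private
  descent-resp : {π ρ : Permutation′ n} → π ≈ ρ → ∀ {i} → Descent π i → Descent ρ i
  descent-resp π≈ρ {i} (j , j≡1+i , lt) = j , j≡1+i , subst₂ _<_ (π≈ρ j) (π≈ρ i) lt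

  flip-cong : {π ρ : Permutation′ n} → π ≈ ρ → flip π ≈ flip ρ
  flip-cong {π = π} {ρ} π≈ρ i =
    trans (cong (π ⟨$⟩ˡ_) (sym (trans (π≈ρ (ρ ⟨$⟩ˡ i)) (inverseʳ ρ)))) (inverseˡ π)

  hasUniqueDescent-resp : {π ρ : Permutation′ n} → π ≈ ρ → HasUniqueDescent π → HasUniqueDescent ρ
  hasUniqueDescent-resp {π = π} {ρ} π≈ρ (i , d , u) =
    i , descent-resp {π = π} {ρ} π≈ρ d , λ e → u (descent-resp {π = ρ} {π} (sym ∘ π≈ρ) e)

bigrassmannian-resp : {π ρ : Permutation′ n} → π ≈ ρ → Bigrassmannian π → Bigrassmannian ρ
bigrassmannian-resp {π = π} {ρ} π≈ρ (u , v) =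
  hasUniqueDescent-resp {π = π} {ρ} π≈ρ u ,
  hasUniqueDescent-resp {π = flip π} {flip ρ} (flip-cong {π = π} {ρ} π≈ρ) v

private
  s₁-hasUniqueDescent : (π : Permutation′ (suc (suc n))) → π ≈ swap id → HasUniqueDescent π
  s₁-hasUniqueDescent {n} π π≈s₁ = hasUniqueDescent-resp {π = swap id} {π} (sym ∘ π≈s₁)
    (zero , (suc zero , refl , s≤s z≤n) , unique _)
    where
    unique : ∀ i → Descent (swap (id {n = n})) i → zero ≡ i
    unique zero          _                                = refl
    unique (suc zero)    (suc (suc zero)    , refl , ())
    unique (suc (suc i)) (suc (suc (suc j)) , eq , lt) =
      ⊥-elim (ℕ.<-asym (ℕ.≤-reflexive (sym (ℕ.suc-injective (ℕ.suc-injective eq))))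
        (s≤s⁻¹ (s≤s⁻¹ lt)))

  s₁-bigrassmannian : Bigrassmannian (swap (id {n = n}))
  s₁-bigrassmannian =
    s₁-hasUniqueDescent (swap id) (λ _ → refl) ,
    s₁-hasUniqueDescent (flip (swap id)) λ { zero → refl ; (suc zero) → refl ; (suc (suc _)) → refl }

  nonEmpty : ∀ {m} {π : Permutation′ m} {πs} → π ∈≈ πs → NonZero (length πs)
  nonEmpty (here _)  = _
  nonEmpty (there _) = _

𝔟-nonZero : ∀ n → .{{NonTrivial n}} → NonZero (𝔟 n)
𝔟-nonZero (suc (suc n)) = nonEmpty {π = s₁} s₁∈𝔅
  where
  s₁ : Permutation′ (suc (suc n))
  s₁ = swap id

  s₁∈𝔅 : s₁ ∈≈ 𝔅 (suc (suc n))
  s₁∈𝔅 = Membershipₚ.∈-filter⁺ (𝔖-setoid (suc (suc n))) bigrassmannian?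
    (λ {π} {ρ} → bigrassmannian-resp {π = π} {ρ})
    {v = s₁} (𝔖-complete s₁) s₁-bigrassmannian

infix 4 _≤ᴮ_

-- `transpose i j ∘ₚ σ` is diagrammatic composition: it is σ with the
-- letters in positions i and j interchanged.
data _≤ᴮ_ (π : Permutation′ n) : Permutation′ n → Set where
  done   : ∀ {σ} → π ≈ σ → π ≤ᴮ σ
  reduce : ∀ {σ} i j → i < j → σ ⟨$⟩ʳ j < σ ⟨$⟩ʳ i →
           π ≤ᴮ transpose i j ∘ₚ σ → π ≤ᴮ σ

Comparable : Rel (Permutation′ n) 0ℓ
Comparable π σ = π ≤ᴮ σ ⊎ σ ≤ᴮ π

-- Decidability of the Bruhat order: a reduction makes the one-line
-- notation lexicographically smaller.
private
  _<ₗ_ : ∀ {m} → Rel (Vec (Fin n) m) 0ℓ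
  _<ₗ_ = Lex.Lex-< _≡_ _<_

  _≺_ : Rel (Permutation′ n) 0ℓ
  _≺_ = _<ₗ_ on λ π → tabulate (π ⟨$⟩ʳ_)

  ≺-wellFounded : WellFounded (_≺_ {n})
  ≺-wellFounded = On.wellFounded _
    (Lex.<-wellFounded trans (λ { refl lt → lt }) <-wellFounded)

  firstDifference : ∀ {m} (f g : Fin m → Fin n) i → f i < g i →
                    (∀ k → k < i → f k ≡ g k) → tabulate f <ₗ tabulate g
  firstDifference f g zero    lt eq = Lex.this lt refl
  firstDifference f g (suc i) lt eq = Lex.next (eq zero (s≤s z≤n))
    (firstDifference (f ∘ suc) (g ∘ suc) i lt λ k k<i → eq (suc k) (s≤s k<i))

  transpose-first : (i j : Fin n) → transpose i j ⟨$⟩ʳ i ≡ j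
  transpose-first i j rewrite dec-true (i ≟ i) refl = refl

  transpose-other : (i j k : Fin n) → k ≢ i → k ≢ j → transpose i j ⟨$⟩ʳ k ≡ k
  transpose-other i j k k≢i k≢j
    rewrite dec-false (k ≟ i) k≢i | dec-false (k ≟ j) k≢j = refl

  reduce-≺ : (σ : Permutation′ n) → ∀ i j → i < j → σ ⟨$⟩ʳ j < σ ⟨$⟩ʳ i → (transpose i j ∘ₚ σ) ≺ σ
  reduce-≺ σ i j i<j lt = firstDifference _ _ i
    (subst (λ k → σ ⟨$⟩ʳ k < σ ⟨$⟩ʳ i) (sym (transpose-first i j)) lt)
    (λ k k<i → cong (σ ⟨$⟩ʳ_) (transpose-other i j k (<⇒≢ k<i) (<⇒≢ (<-trans k<i i<j))))

  ≤ᴮ-dec : (π σ : Permutation′ n) → Acc _≺_ σ → Dec (π ≤ᴮ σ)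
  ≤ᴮ-dec {n} π σ (acc rec) = map′ to from
    ((π ≈? σ) ⊎-dec any? λ i → any? λ j → step? i j)
    where
    Step : Fin n → Fin n → Set
    Step i j = ∃ λ (_ : i < j × σ ⟨$⟩ʳ j < σ ⟨$⟩ʳ i) → π ≤ᴮ transpose i j ∘ₚ σ

    step? : ∀ i j → Dec (Step i j)
    step? i j with (i <? j) ×-dec ((σ ⟨$⟩ʳ j) <? (σ ⟨$⟩ʳ i))
    ... | no ¬inv = no (¬inv ∘ proj₁)
    ... | yes inv = map′ (inv ,_) proj₂
      (≤ᴮ-dec π (transpose i j ∘ₚ σ) (rec (reduce-≺ σ i j (proj₁ inv) (proj₂ inv))))

    to : π ≈ σ ⊎ ∃₂ Step → π ≤ᴮ σ
    to (inj₁ π≈σ) = done π≈σ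
    to (inj₂ (i , j , (i<j , lt) , le)) = reduce i j i<j lt le

    from : π ≤ᴮ σ → π ≈ σ ⊎ ∃₂ Step
    from (done π≈σ) = inj₁ π≈σ
    from (reduce i j i<j lt le) = inj₂ (i , j , (i<j , lt) , le)

_≤ᴮ?_ : (π σ : Permutation′ n) → Dec (π ≤ᴮ σ)
π ≤ᴮ? σ = ≤ᴮ-dec π σ (≺-wellFounded σ)

comparable? : (π σ : Permutation′ n) → Dec (Comparable π σ)
comparable? π σ = (π ≤ᴮ? σ) ⊎-dec (σ ≤ᴮ? π)

-- The probability of an event under the uniform distribution on the
-- entries of a list.
ℙ : {A : Set a} (Ω : List A) → .{{NonZero (length Ω)}} →
    {P : Pred A p} → Decidable P → ℚ
ℙ Ω P? = + length (filter P? Ω) / length Ω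

-- Independent uniform choices of π and σ: a uniform choice of (π , σ).
𝔅² : (n : ℕ) → List (Permutation′ n × Permutation′ n)
𝔅² n = cartesianProduct (𝔅 n) (𝔅 n)

𝔅²-nonZero : ∀ n → .{{NonTrivial n}} → NonZero (length (𝔅² n))
𝔅²-nonZero n = nz (𝔅 n) {{𝔟-nonZero n}}
  where
  nz : (πs : List (Permutation′ n)) → .{{NonZero (length πs)}} →
       NonZero (length (cartesianProduct πs πs))
  nz (_ ∷ _) = _

k*𝔟-nonZero : ∀ k n → .{{NonZero k}} → .{{NonTrivial n}} → NonZero (k * 𝔟 n)
k*𝔟-nonZero k n = ℕ.m*n≢0 k (𝔟 n) {{it}} {{𝔟-nonZero n}}

p₂ : (n : ℕ) → .{{NonTrivial n}} → ℚ
p₂ n = ℙ (𝔅² n) {{𝔅²-nonZero n}} (uncurry comparable?)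

p₂≤ : (n : ℕ) → .{{NonTrivial n}} → ℚ
p₂≤ n = ℙ (𝔅² n) {{𝔅²-nonZero n}} (uncurry _≤ᴮ?_)

{-# OPTIONS --safe #-}

-- A bigrassmannian permutation exchanges two adjacent blocks; record it as (p , q , r , s), where p and
-- s count the fixed letters at either end and q + 1, r + 1 are the sizes of the blocks.
-- Pointwise bounds by monotone functions survive reductions.  Applied to the bounds x + q + 1,
-- x - (r + 1), min(x , p) and max(x , n - s - 1), this shows that going down in Bruhat order increases
-- p and s and decreases q and r.  Conversely, each of the four ways of lengthening an end and shortening
-- a block by one letter is a sequence of reductions, and these moves generate the componentwise order.
-- A pair π ≤ σ thus amounts to p, q, r, s and increments with x + y = z + t, where
-- p + q + r + s + (x + y) = n - 2; with m = n - 2 there are C(m + 6 , 6) + C(m + 5 , 6) of them, which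
-- is b(n) b(n + 2) / 10.  By antisymmetry the comparable pairs number twice that, less b(n).

module Submission where

open import Defs
open import Data.Bool.Base using (true; false; if_then_else_)
open import Data.Empty using (⊥-elim)
open import Data.Fin.Base as Fin using (Fin; zero; suc; toℕ; fromℕ<)
open import Data.Fin.Permutation
  using (Permutation′; permutation; _⟨$⟩ʳ_; _≈_; _∘ₚ_; flip; transpose; inverseˡ)
open import Data.Fin.Properties as Fin
  using (toℕ<n; fromℕ<-toℕ; toℕ-fromℕ<; toℕ-injective; injective⇒≤)
import Data.Integer.Properties as ℤ
import Data.Integer.Tactic.RingSolver as ℤ
open import Data.List.Base
  using (List; []; _∷_; _++_; length; lookup; map; filter; cartesianProduct)
open import Data.List.Membership.Propositional using (_∈_)
import Data.List.Membership.Propositional.Properties as ∈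
import Data.List.Membership.Setoid as Membership
import Data.List.Membership.Setoid.Properties as Membershipₚ
open import Data.List.Properties using (length-++; length-map)
open import Data.List.Relation.Unary.All as All using ([])
open import Data.List.Relation.Unary.AllPairs using ([]; _∷_)
open import Data.List.Relation.Unary.Any using (here; index)
open import Data.List.Relation.Unary.Unique.Propositional using (Unique)
import Data.List.Relation.Unary.Unique.Propositional.Properties as Unique
import Data.List.Relation.Unary.Unique.Setoid as UniqueSetoid
import Data.List.Relation.Unary.Unique.Setoid.Properties as Uniqueₚ
open import Data.Nat.Base
  using (ℕ; zero; suc; _+_; _*_; _∸_; _⊓_; _⊔_; _≤_; _<_; z≤n; s≤s; s≤s⁻¹; z<s; s<s;
         NonZero; NonTrivial)
open import Data.Nat.Properties
open import Data.Nat.Tactic.RingSolver using (solve-∀)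
open import Data.Product.Base using (∃; ∃₂; _×_; _,_; proj₁; proj₂; swap; uncurry)
open import Data.Product.Relation.Binary.Pointwise.NonDependent using (_×ₛ_)
open import Data.Rational.Base using (_/_)
open import Data.Rational.Properties using (fromℚᵘ-cong)
open import Data.Rational.Unnormalised.Base using (mkℚᵘ; *≡*)
open import Data.Sum.Base using (_⊎_; inj₁; inj₂; [_,_]′)
open import Data.Vec.Base using (Vec; []; _∷_; sum)
open import Data.Vec.Properties using (∷-injective; ∷-injectiveʳ)
open import Function.Base using (_∘_; id)
open import Level using (Level; 0ℓ)
open import Relation.Binary.Bundles using (Setoid)
open import Relation.Binary.Construct.Closure.ReflexiveTransitive using (Star; ε; _◅_)
open import Relation.Binary.Definitions using (tri<; tri≈; tri>)
open import Relation.Binary.PropositionalEquality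
open import Relation.Nullary using (¬_; does; yes; no)
open import Relation.Nullary.Decidable using (dec-true; dec-false)
open import Relation.Unary using (Pred; Decidable)
open import Relation.Unary.Properties using (_∪?_; _∩?_)

-- Subtracting one from each block size turns the codes for n into exactly the weak compositions of
-- n - 2 into four parts, so no boundary cases remain. The fixed sum also shapes the order: each
-- unit lost by an end is gained by a block, so the increments pair off into unit moves, and
-- counting comparable pairs becomes counting the solutions of x + y = z + t. Splitting these by x ≤
-- z or z < x leaves seven free summands in each half, whence the two binomial coefficients;
-- strictness uses up one unit, whence m + 5 instead of m + 6. The obstacle is that permutations are
-- equal only up to `_≈_`. They are therefore matched with codes by the relation `Encodes`, and
-- cardinalities are compared along relations that are injective both ways up to the setoid
-- equalities. That a permutation has only one code needs no separate analysis of blocks: `π ≈ σ`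
-- gives `π ≤ᴮ σ` and `σ ≤ᴮ π`, and the componentwise order is antisymmetric.

private
  variable
    ℓ ℓ₁ ℓ₂ : Level
    k n : ℕ

-- Counting lists without repetitions

module _ (S : Setoid ℓ₁ ℓ₂) where

  open Setoid S using () renaming (_≈_ to _≈₁_; sym to sym₁; trans to trans₁)

  private
    lookup-≉ : ∀ {x xs} → All.All (λ y → ¬ x ≈₁ y) xs → ∀ i → ¬ x ≈₁ lookup xs i
    lookup-≉ {xs = xs} x∉xs i = All.lookupₛ S (λ y≈z x≉y x≈z → x≉y (trans₁ x≈z (sym₁ y≈z))) x∉xs
      (Membershipₚ.∈-lookup S xs i)

  lookup-injective : ∀ {xs} → UniqueSetoid.Unique S xs →
                     ∀ {i j} → lookup xs i ≈₁ lookup xs j → i ≡ j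
  lookup-injective (_    ∷ _)   {zero}  {zero}  _  = refl
  lookup-injective (x∉xs ∷ _)   {zero}  {suc j} eq = ⊥-elim (lookup-≉ x∉xs j eq)
  lookup-injective (x∉xs ∷ _)   {suc i} {zero}  eq = ⊥-elim (lookup-≉ x∉xs i (sym₁ eq))
  lookup-injective (_    ∷ xs!) {suc i} {suc j} eq = cong suc (lookup-injective xs! eq)

module _ {s₁ s₂ t₁ t₂ r : Level} (S : Setoid s₁ s₂) (T : Setoid t₁ t₂) where

  open Setoid S using () renaming (Carrier to A; _≈_ to _≈₁_)
  open Setoid T using () renaming (Carrier to B; _≈_ to _≈₂_)
  open Membership S using () renaming (_∈_ to _∈₁_)
  open Membership T using () renaming (_∈_ to _∈₂_)

  -- Each position in `xs` is sent to the position in `ys` of a chosen partner. Injectivity of `R`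
  -- makes this an injection between finite index sets, so no choice of partners has to respect the
  -- setoid equalities.
  length-≤ : (R : A → B → Set r) → ∀ {xs ys} → UniqueSetoid.Unique S xs →
             (∀ {x} → x ∈₁ xs → ∃ λ y → y ∈₂ ys × R x y) →
             (∀ {x x′ y y′} → R x y → R x′ y′ → y ≈₂ y′ → x ≈₁ x′) →
             length xs ≤ length ys
  length-≤ R {xs} {ys} xs! total inj = injective⇒≤ {f = index ∘ y∈} λ {i} {j} eq →
    lookup-injective S xs!
      (inj (Rxy i) (Rxy j) (Membershipₚ.index-injective T (y∈ i) (y∈ j) eq))
    where
    image = λ i → total (Membershipₚ.∈-lookup S xs i)
    y∈ = proj₁ ∘ proj₂ ∘ image
    Rxy = proj₂ ∘ proj₂ ∘ image

module _ {s₁ s₂ t₁ t₂ r : Level} (S : Setoid s₁ s₂) (T : Setoid t₁ t₂) where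

  open Setoid S using () renaming (Carrier to A; _≈_ to _≈₁_)
  open Setoid T using () renaming (Carrier to B; _≈_ to _≈₂_)
  open Membership S using () renaming (_∈_ to _∈₁_)
  open Membership T using () renaming (_∈_ to _∈₂_)

  length-≡ : (R : A → B → Set r) → ∀ {xs ys} →
             UniqueSetoid.Unique S xs → UniqueSetoid.Unique T ys →
             (∀ {x} → x ∈₁ xs → ∃ λ y → y ∈₂ ys × R x y) →
             (∀ {y} → y ∈₂ ys → ∃ λ x → x ∈₁ xs × R x y) →
             (∀ {x x′ y y′} → R x y → R x′ y′ → y ≈₂ y′ → x ≈₁ x′) →
             (∀ {x x′ y y′} → R x y → R x′ y′ → x ≈₁ x′ → y ≈₂ y′) →
             length xs ≡ length ys
  length-≡ R xs! ys! total total′ inj inj′ = ≤-antisym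
    (length-≤ S T R xs! total inj)
    (length-≤ T S (λ y x → R x y) ys! total′ inj′)

module _ {A : Set ℓ} {P : Pred A ℓ₁} {Q : Pred A ℓ₂} (P? : Decidable P) (Q? : Decidable Q) where

  length-filter-∪ : ∀ xs → length (filter (P? ∪? Q?) xs) + length (filter (P? ∩? Q?) xs) ≡
                           length (filter P? xs) + length (filter Q? xs)
  length-filter-∪ [] = refl
  length-filter-∪ (x ∷ xs) with does (P? x) | does (Q? x) | length-filter-∪ xs
  ... | true  | true  | ih = cong suc (trans (+-suc _ _) (trans (cong suc ih) (sym (+-suc _ _))))
  ... | true  | false | ih = cong suc ih
  ... | false | true  | ih = trans (cong suc ih) (sym (+-suc _ _))
  ... | false | false | ih = ih

length-cartesianProduct : {A : Set ℓ₁} {B : Set ℓ₂} (xs : List A) (ys : List B) →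
                          length (cartesianProduct xs ys) ≡ length xs * length ys
length-cartesianProduct []       ys = refl
length-cartesianProduct (x ∷ xs) ys = trans (length-++ (map (x ,_) ys))
  (cong₂ _+_ (length-map (x ,_) ys) (length-cartesianProduct xs ys))

-- Weak compositions and their number

sucHead : Vec ℕ (suc k) → Vec ℕ (suc k)
sucHead (x ∷ xs) = suc x ∷ xs

-- Weak compositions: parts may be zero.
compositions : ∀ k → ℕ → List (Vec ℕ k)
compositions zero    zero    = [] ∷ []
compositions zero    (suc n) = []
compositions (suc k) zero    = map (0 ∷_) (compositions k zero)
compositions (suc k) (suc n) =
  map sucHead (compositions (suc k) n) ++ map (0 ∷_) (compositions k (suc n))

∈-compositions⁺ : ∀ (v : Vec ℕ k) {n} → sum v ≡ n → v ∈ compositions k n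
∈-compositions⁺ []                   refl = here refl
∈-compositions⁺ (suc x ∷ v)          refl =
  ∈.∈-++⁺ˡ (∈.∈-map⁺ sucHead (∈-compositions⁺ (x ∷ v) refl))
∈-compositions⁺ (zero ∷ v) {zero}    eq   = ∈.∈-map⁺ (0 ∷_) (∈-compositions⁺ v eq)
∈-compositions⁺ (zero ∷ v) {suc n}   eq   =
  ∈.∈-++⁺ʳ (map sucHead (compositions _ n)) (∈.∈-map⁺ (0 ∷_) (∈-compositions⁺ v eq))

∈-compositions⁻ : ∀ k n {v : Vec ℕ k} → v ∈ compositions k n → sum v ≡ n
∈-compositions⁻ zero    zero    (here refl) = refl
∈-compositions⁻ (suc k) zero    v∈ with ∈.∈-map⁻ (0 ∷_) v∈
... | w , w∈ , refl = ∈-compositions⁻ k zero w∈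
∈-compositions⁻ (suc k) (suc n) v∈ with ∈.∈-++⁻ (map sucHead (compositions (suc k) n)) v∈
... | inj₁ v∈ˡ with ∈.∈-map⁻ sucHead v∈ˡ
...   | x ∷ w , w∈ , refl = cong suc (∈-compositions⁻ (suc k) n w∈)
∈-compositions⁻ (suc k) (suc n) v∈ | inj₂ v∈ʳ with ∈.∈-map⁻ (0 ∷_) v∈ʳ
...   | w , w∈ , refl = ∈-compositions⁻ k (suc n) w∈

compositions-! : ∀ k n → Unique (compositions k n)
compositions-! zero    zero    = [] ∷ []
compositions-! zero    (suc n) = []
compositions-! (suc k) zero    = Unique.map⁺ ∷-injectiveʳ (compositions-! k zero)
compositions-! (suc k) (suc n) = Unique.++⁺
  (Unique.map⁺ (λ {v} {w} → sucHead-injective v w) (compositions-! (suc k) n))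
  (Unique.map⁺ ∷-injectiveʳ (compositions-! k (suc n)))
  λ (v∈ˡ , v∈ʳ) → disjoint (∈.∈-map⁻ sucHead v∈ˡ) (∈.∈-map⁻ (0 ∷_) v∈ʳ)
  where
  sucHead-injective : ∀ (v w : Vec ℕ (suc k)) → sucHead v ≡ sucHead w → v ≡ w
  sucHead-injective (x ∷ v) (x ∷ v) refl = refl

  disjoint : ∀ {v} {xs : List (Vec ℕ (suc k))} {ys : List (Vec ℕ k)} →
             (∃ λ w → w ∈ xs × v ≡ sucHead w) → ¬ (∃ λ w → w ∈ ys × v ≡ 0 ∷ w)
  disjoint (x ∷ w , _ , refl) (_ , _ , ())

#comp : ℕ → ℕ → ℕ
#comp k n = length (compositions k n)

#comp-zero : ∀ k → #comp k 0 ≡ 1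
#comp-zero zero    = refl
#comp-zero (suc k) = trans (length-map (0 ∷_) (compositions k 0)) (#comp-zero k)

-- Pascal's rule, since `#comp (suc k) n` is the binomial coefficient C(n + k , k): the first part
-- is either positive or zero.
#comp-suc : ∀ k n → #comp (suc k) (suc n) ≡ #comp (suc k) n + #comp k (suc n)
#comp-suc k n = trans (length-++ (map sucHead (compositions (suc k) n)))
  (cong₂ _+_ (length-map sucHead (compositions (suc k) n))
             (length-map (0 ∷_) (compositions k (suc n))))

-- Summation with cleared denominators: the hypotheses make `f` the sequence of partial sums of
-- `c * g`. The uses take d = (k - 1)! and c = k, so the new denominator is k! and `f` gains one
-- linear factor over `g`.
#comp-step : ∀ k d c (f g : ℕ → ℕ) → (∀ n → d * #comp k n ≡ g n) →
             f 0 ≡ c * d → (∀ n → f n + c * g (suc n) ≡ f (suc n)) →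
             ∀ n → c * d * #comp (suc k) n ≡ f n
#comp-step k d c f g #g f0 fsuc zero =
  trans (cong (c * d *_) (#comp-zero (suc k))) (trans (*-identityʳ _) (sym f0))
#comp-step k d c f g #g f0 fsuc (suc n) = begin
  c * d * #comp (suc k) (suc n)                      ≡⟨ cong (c * d *_) (#comp-suc k n) ⟩
  c * d * (#comp (suc k) n + #comp k (suc n))        ≡⟨ lemma c d _ _ ⟩
  c * d * #comp (suc k) n + c * (d * #comp k (suc n))
    ≡⟨ cong₂ (λ x y → x + c * y) (#comp-step k d c f g #g f0 fsuc n) (#g (suc n)) ⟩
  f n + c * g (suc n)                                ≡⟨ fsuc n ⟩
  f (suc n)                                          ∎
  where
  open ≡-Reasoning
  lemma : ∀ c d x y → c * d * (x + y) ≡ c * d * x + c * (d * y)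
  lemma = solve-∀

#comp₁ : ∀ n → 1 * #comp 1 n ≡ 1
#comp₁ zero    = refl
#comp₁ (suc n) = trans (cong (1 *_) (trans (#comp-suc 0 n) (+-identityʳ _))) (#comp₁ n)

#comp₄ : ∀ n → 6 * #comp 4 n ≡ (n + 1) * (n + 2) * (n + 3)
#comp₄ =
  #comp-step 3 2 3 (λ n → (n + 1) * (n + 2) * (n + 3)) (λ n → (n + 1) * (n + 2))
    (#comp-step 2 1 2 _ (λ n → n + 1)
      (#comp-step 1 1 1 _ (λ _ → 1) #comp₁ refl lem₁)
      refl lem₂)
    refl lem₃
  where
  lem₁ : ∀ n → n + 1 + 1 * 1 ≡ suc n + 1
  lem₁ = solve-∀
  lem₂ : ∀ n → (n + 1) * (n + 2) + 2 * (suc n + 1) ≡ (suc n + 1) * (suc n + 2)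
  lem₂ = solve-∀
  lem₃ : ∀ n → (n + 1) * (n + 2) * (n + 3) + 3 * ((suc n + 1) * (suc n + 2)) ≡
               (suc n + 1) * (suc n + 2) * (suc n + 3)
  lem₃ = solve-∀

#comp₇ : ∀ n → 720 * #comp 7 n ≡ (n + 1) * (n + 2) * (n + 3) * (n + 4) * (n + 5) * (n + 6)
#comp₇ =
  #comp-step 6 120 6
    (λ n → (n + 1) * (n + 2) * (n + 3) * (n + 4) * (n + 5) * (n + 6))
    (λ n → (n + 1) * (n + 2) * (n + 3) * (n + 4) * (n + 5))
    (#comp-step 5 24 5 _ (λ n → (n + 1) * (n + 2) * (n + 3) * (n + 4))
      (#comp-step 4 6 4 _ (λ n → (n + 1) * (n + 2) * (n + 3)) #comp₄
        refl lem₄)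
      refl lem₅)
    refl lem₆
  where
  lem₄ : ∀ n → (n + 1) * (n + 2) * (n + 3) * (n + 4) + 4 * ((suc n + 1) * (suc n + 2) * (suc n + 3)) ≡
               (suc n + 1) * (suc n + 2) * (suc n + 3) * (suc n + 4)
  lem₄ = solve-∀
  lem₅ : ∀ n → (n + 1) * (n + 2) * (n + 3) * (n + 4) * (n + 5) +
                 5 * ((suc n + 1) * (suc n + 2) * (suc n + 3) * (suc n + 4)) ≡
               (suc n + 1) * (suc n + 2) * (suc n + 3) * (suc n + 4) * (suc n + 5)
  lem₅ = solve-∀
  lem₆ : ∀ n → (n + 1) * (n + 2) * (n + 3) * (n + 4) * (n + 5) * (n + 6) +
                 6 * ((suc n + 1) * (suc n + 2) * (suc n + 3) * (suc n + 4) * (suc n + 5)) ≡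
               (suc n + 1) * (suc n + 2) * (suc n + 3) * (suc n + 4) * (suc n + 5) * (suc n + 6)
  lem₆ = solve-∀

-- The componentwise order on codes

Code : Set
Code = Vec ℕ 4

infix 4 _≼_
_≼_ : Code → Code → Set
(p ∷ q ∷ r ∷ s ∷ []) ≼ (p′ ∷ q′ ∷ r′ ∷ s′ ∷ []) = (p′ ≤ p × s′ ≤ s) × q ≤ q′ × r ≤ r′

≼-refl : ∀ v → v ≼ v
≼-refl (_ ∷ _ ∷ _ ∷ _ ∷ []) = (≤-refl , ≤-refl) , ≤-refl , ≤-refl

≼-antisym : ∀ v w → v ≼ w → w ≼ v → v ≡ w
≼-antisym (_ ∷ _ ∷ _ ∷ _ ∷ []) (_ ∷ _ ∷ _ ∷ _ ∷ []) ((a , b) , c , d) ((a′ , b′) , c′ , d′)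
  with refl ← ≤-antisym a a′ | refl ← ≤-antisym b b′
     | refl ← ≤-antisym c c′ | refl ← ≤-antisym d d′ = refl

-- v ≼ w with equal sums means v = (p + x , q , r , s + y) and w = (p , q + z , r + t , s)
-- with x + y = z + t.  The solutions of the latter with x ≤ z are x = u, y = v + t,
-- z = u + v; those with z < x are z = u, x = u + v + 1, t = v + 1 + y.
pairˡ pairʳ : Vec ℕ 7 → Code × Code
pairˡ (p ∷ s ∷ q ∷ r ∷ u ∷ v ∷ t ∷ []) =
  (p + u ∷ q ∷ r ∷ s + (v + t) ∷ []) , (p ∷ q + (u + v) ∷ r + t ∷ s ∷ [])
pairʳ (p ∷ s ∷ q ∷ r ∷ u ∷ v ∷ y ∷ []) =
  (p + suc (u + v) ∷ q ∷ r ∷ s + y ∷ []) , (p ∷ q + u ∷ r + suc (v + y) ∷ s ∷ [])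

-- The `suc` that makes `pairʳ` strict adds one to both sums, so its seven parameters sum to one
-- less than m and it contributes nothing for m = 0.
intervals : ℕ → List (Code × Code)
intervals zero    = map pairˡ (compositions 7 zero)
intervals (suc m) = map pairˡ (compositions 7 (suc m)) ++ map pairʳ (compositions 7 m)

private
  +-∷-cancel : ∀ {k a x y} {xs ys : Vec ℕ k} → (a + x) ∷ xs ≡ (a + y) ∷ ys → x ≡ y × xs ≡ ys
  +-∷-cancel {a = a} eq = +-cancelˡ-≡ a _ _ (proj₁ (∷-injective eq)) , proj₂ (∷-injective eq)

pairˡ-injective : ∀ {v w} → pairˡ v ≡ pairˡ w → v ≡ w
pairˡ-injective {p ∷ s ∷ q ∷ r ∷ u ∷ v ∷ t ∷ []} {p′ ∷ s′ ∷ q′ ∷ r′ ∷ u′ ∷ v′ ∷ t′ ∷ []} eq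
  with eq₁ ← cong proj₁ eq | eq₂ ← cong proj₂ eq
  with refl , e₂ ← ∷-injective eq₂
  with refl , e₁ ← +-∷-cancel {a = p} eq₁
  with refl , e₁ ← ∷-injective e₁
  with refl , e₁ ← ∷-injective e₁
  with e , e₂ ← +-∷-cancel {a = q} e₂
  with refl ← +-cancelˡ-≡ u _ _ e
  with refl , refl ← +-∷-cancel {a = r} e₂
  = refl

pairʳ-injective : ∀ {v w} → pairʳ v ≡ pairʳ w → v ≡ w
pairʳ-injective {p ∷ s ∷ q ∷ r ∷ u ∷ v ∷ y ∷ []} {p′ ∷ s′ ∷ q′ ∷ r′ ∷ u′ ∷ v′ ∷ y′ ∷ []} eq
  with eq₁ ← cong proj₁ eq | eq₂ ← cong proj₂ eq
  with refl , e₂ ← ∷-injective eq₂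
  with e , e₁ ← +-∷-cancel {a = p} eq₁
  with refl , e₁ ← ∷-injective e₁
  with refl , e₁ ← ∷-injective e₁
  with refl , e₂ ← +-∷-cancel {a = q} e₂
  with refl ← +-cancelˡ-≡ u _ _ (suc-injective e)
  with e , refl ← +-∷-cancel {a = r} e₂
  with refl ← +-cancelˡ-≡ v _ _ (suc-injective e)
  = refl

-- The increments x of the prefix and z of the lower block can be read off from the pair of codes,
-- and x ≤ z in one family while z < x in the other.
pairˡ≢pairʳ : ∀ v w → pairˡ v ≢ pairʳ w
pairˡ≢pairʳ (p ∷ s ∷ q ∷ r ∷ u ∷ v ∷ t ∷ []) (p′ ∷ s′ ∷ q′ ∷ r′ ∷ u′ ∷ v′ ∷ t′ ∷ []) eq
  with eq₁ ← cong proj₁ eq | eq₂ ← cong proj₂ eq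
  with refl , e₂ ← ∷-injective eq₂
  with refl , e₁ ← +-∷-cancel {a = p} eq₁
  with refl , e₁ ← ∷-injective e₁
  with e , _ ← +-∷-cancel {a = q} e₂
  = m≢1+m+n u′ (sym (trans (lemma u′ v′ v) e))
  where
  lemma : ∀ u v w → suc (u + (v + w)) ≡ suc (u + v) + w
  lemma = solve-∀

intervals-! : ∀ m → Unique (intervals m)
intervals-! zero    = Unique.map⁺ pairˡ-injective (compositions-! 7 zero)
intervals-! (suc m) = Unique.++⁺
  (Unique.map⁺ pairˡ-injective (compositions-! 7 (suc m)))
  (Unique.map⁺ pairʳ-injective (compositions-! 7 m))
  λ (∈ˡ , ∈ʳ) → let v , _ , eqˡ = ∈.∈-map⁻ pairˡ ∈ˡ; w , _ , eqʳ = ∈.∈-map⁻ pairʳ ∈ʳ in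
    pairˡ≢pairʳ v w (trans (sym eqˡ) eqʳ)

private
  sum-raised : ∀ p q r s x y → p + x + (q + (r + (s + y + 0))) ≡ p + q + r + s + (x + y)
  sum-raised = solve-∀

  sum-lowered : ∀ p q r s z t → p + (q + z + (r + t + (s + 0))) ≡ p + q + r + s + (z + t)
  sum-lowered = solve-∀

∈-intervals⁺ : ∀ {v w} m → sum v ≡ m → sum w ≡ m → v ≼ w → (v , w) ∈ intervals m
∈-intervals⁺ {p₁ ∷ q ∷ r ∷ s₁ ∷ []} {p ∷ q₁ ∷ r₁ ∷ s ∷ []} m sum-v sum-w ((p≤ , s≤) , q≤ , r≤)
  with x , refl ← m≤n⇒∃[o]m+o≡n p≤ | y , refl ← m≤n⇒∃[o]m+o≡n s≤
     | z , refl ← m≤n⇒∃[o]m+o≡n q≤ | t , refl ← m≤n⇒∃[o]m+o≡n r≤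
  = [ ˡ , ʳ ]′ (≤-<-connex x z)
  where
  x+y≡z+t : x + y ≡ z + t
  x+y≡z+t = +-cancelˡ-≡ (p + q + r + s) (x + y) (z + t)
    (trans (sym (sum-raised p q r s x y)) (trans sum-v (trans (sym sum-w) (sum-lowered p q r s z t))))

  sumˡ : ∀ p q r s x v t → p + (s + (q + (r + (x + (v + (t + 0)))))) ≡
                           p + x + (q + (r + (s + (v + t) + 0)))
  sumˡ = solve-∀

  sumʳ : ∀ p q r s z v y → suc (p + (s + (q + (r + (z + (v + (y + 0))))))) ≡
                           p + suc (z + v) + (q + (r + (s + y + 0)))
  sumʳ = solve-∀

  regroup : ∀ z v y → z + suc (v + y) ≡ suc (z + v) + y
  regroup = solve-∀

  ∈-ˡ : ∀ m {vw} → vw ∈ map pairˡ (compositions 7 m) → vw ∈ intervals m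
  ∈-ˡ zero    = id
  ∈-ˡ (suc m) = ∈.∈-++⁺ˡ

  ∈-ʳ : ∀ {m} v → suc (sum v) ≡ m → pairʳ v ∈ intervals m
  ∈-ʳ v refl = ∈.∈-++⁺ʳ (map pairˡ (compositions 7 (suc (sum v))))
    (∈.∈-map⁺ pairʳ (∈-compositions⁺ v refl))

  ˡ : x ≤ z → _ ∈ intervals m
  ˡ x≤z with v , refl ← m≤n⇒∃[o]m+o≡n x≤z
    with refl ← +-cancelˡ-≡ x y (v + t) (trans x+y≡z+t (+-assoc x v t))
    = ∈-ˡ m (∈.∈-map⁺ pairˡ (∈-compositions⁺ (p ∷ s ∷ q ∷ r ∷ x ∷ v ∷ t ∷ [])
        (trans (sumˡ p q r s x v t) sum-v)))

  ʳ : z < x → _ ∈ intervals m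
  ʳ z<x with v , refl ← m≤n⇒∃[o]m+o≡n z<x
    with refl ← +-cancelˡ-≡ z t (suc (v + y)) (trans (sym x+y≡z+t) (sym (regroup z v y)))
    = ∈-ʳ (p ∷ s ∷ q ∷ r ∷ z ∷ v ∷ y ∷ []) (trans (sumʳ p q r s z v y) sum-v)

∈-intervals⁻ : ∀ m {v w} → (v , w) ∈ intervals m → (sum v ≡ m × sum w ≡ m) × v ≼ w
∈-intervals⁻ m vw∈ = split m vw∈
  where
  Interval : ℕ → Code × Code → Set
  Interval m (v , w) = (sum v ≡ m × sum w ≡ m) × v ≼ w

  sumˡ₁ : ∀ p q r s u v t → p + u + (q + (r + (s + (v + t) + 0))) ≡
                            p + (s + (q + (r + (u + (v + (t + 0))))))
  sumˡ₁ = solve-∀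
  sumˡ₂ : ∀ p q r s u v t → p + (q + (u + v) + (r + t + (s + 0))) ≡
                            p + (s + (q + (r + (u + (v + (t + 0))))))
  sumˡ₂ = solve-∀
  sumʳ₁ : ∀ p q r s u v y → p + suc (u + v) + (q + (r + (s + y + 0))) ≡
                            suc (p + (s + (q + (r + (u + (v + (y + 0)))))))
  sumʳ₁ = solve-∀
  sumʳ₂ : ∀ p q r s u v y → p + (q + u + (r + suc (v + y) + (s + 0))) ≡
                            suc (p + (s + (q + (r + (u + (v + (y + 0)))))))
  sumʳ₂ = solve-∀

  intervalˡ : ∀ v → Interval (sum v) (pairˡ v)
  intervalˡ (p ∷ s ∷ q ∷ r ∷ u ∷ v ∷ t ∷ []) =
    (sumˡ₁ p q r s u v t , sumˡ₂ p q r s u v t) ,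
    (m≤m+n _ _ , m≤m+n _ _) , m≤m+n _ _ , m≤m+n _ _

  intervalʳ : ∀ v → Interval (suc (sum v)) (pairʳ v)
  intervalʳ (p ∷ s ∷ q ∷ r ∷ u ∷ v ∷ y ∷ []) =
    (sumʳ₁ p q r s u v y , sumʳ₂ p q r s u v y) ,
    (m≤m+n _ _ , m≤m+n _ _) , m≤m+n _ _ , m≤m+n _ _

  fromˡ : ∀ m {vw} → vw ∈ map pairˡ (compositions 7 m) → Interval m vw
  fromˡ m ∈ˡ with u , u∈ , refl ← ∈.∈-map⁻ pairˡ ∈ˡ
    = subst (λ k → Interval k (pairˡ u)) (∈-compositions⁻ 7 m u∈) (intervalˡ u)

  fromʳ : ∀ m {vw} → vw ∈ map pairʳ (compositions 7 m) → Interval (suc m) vw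
  fromʳ m ∈ʳ with u , u∈ , refl ← ∈.∈-map⁻ pairʳ ∈ʳ
    = subst (λ k → Interval (suc k) (pairʳ u)) (∈-compositions⁻ 7 m u∈) (intervalʳ u)

  split : ∀ m {vw} → vw ∈ intervals m → Interval m vw
  split zero    = fromˡ zero
  split (suc m) = [ fromˡ (suc m) , fromʳ m ]′ ∘ ∈.∈-++⁻ (map pairˡ (compositions 7 (suc m)))

-- C(m + 6 , 6) and C(m + 5 , 6) share the factors m + 1, ..., m + 5; the remaining ones add up to
-- (m + 6) + m = 2 (m + 3). The doubled m + 3 lets the product split into the triples (m + 1)(m +
-- 2)(m + 3) and (m + 3)(m + 4)(m + 5), which are six times the two factors on the right. The
-- constant is then 6! / (2 * 6 * 6) = 10.
#intervals : ∀ m → 10 * length (intervals m) ≡ #comp 4 m * #comp 4 (2 + m)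
#intervals m = *-cancelˡ-≡ _ _ 72 (begin
  72 * (10 * length (intervals m))         ≡⟨ *-assoc 72 10 (length (intervals m)) ⟨
  720 * length (intervals m)               ≡⟨ polynomial m ⟩
  2 * ((m + 1) * (m + 2) * (m + 3) * ((2 + m + 1) * (2 + m + 2) * (2 + m + 3)))
    ≡⟨ cong₂ (λ x y → 2 * (x * y)) (#comp₄ m) (#comp₄ (2 + m)) ⟨
  2 * (6 * #comp 4 m * (6 * #comp 4 (2 + m))) ≡⟨ rearrange (#comp 4 m) (#comp 4 (2 + m)) ⟩
  72 * (#comp 4 m * #comp 4 (2 + m))       ∎)
  where
  open ≡-Reasoning

  rearrange : ∀ x y → 2 * (6 * x * (6 * y)) ≡ 72 * (x * y)
  rearrange = solve-∀

  factor : ∀ m → (suc m + 1) * (suc m + 2) * (suc m + 3) * (suc m + 4) * (suc m + 5) * (suc m + 6) +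
                 (m + 1) * (m + 2) * (m + 3) * (m + 4) * (m + 5) * (m + 6) ≡
                 2 * ((suc m + 1) * (suc m + 2) * (suc m + 3) *
                      ((3 + m + 1) * (3 + m + 2) * (3 + m + 3)))
  factor = solve-∀

  polynomial : ∀ m → 720 * length (intervals m) ≡
               2 * ((m + 1) * (m + 2) * (m + 3) * ((2 + m + 1) * (2 + m + 2) * (2 + m + 3)))
  polynomial zero    = refl
  polynomial (suc m) = begin
    720 * length (intervals (suc m))
      ≡⟨ cong (720 *_) (length-++ (map pairˡ (compositions 7 (suc m)))) ⟩
    720 * (length (map pairˡ (compositions 7 (suc m))) + length (map pairʳ (compositions 7 m)))
      ≡⟨ cong₂ (λ x y → 720 * (x + y)) (length-map pairˡ (compositions 7 (suc m)))
                                       (length-map pairʳ (compositions 7 m)) ⟩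
    720 * (#comp 7 (suc m) + #comp 7 m)
      ≡⟨ *-distribˡ-+ 720 (#comp 7 (suc m)) (#comp 7 m) ⟩
    720 * #comp 7 (suc m) + 720 * #comp 7 m
      ≡⟨ cong₂ _+_ (#comp₇ (suc m)) (#comp₇ m) ⟩
    (suc m + 1) * (suc m + 2) * (suc m + 3) * (suc m + 4) * (suc m + 5) * (suc m + 6) +
    (m + 1) * (m + 2) * (m + 3) * (m + 4) * (m + 5) * (m + 6)
      ≡⟨ factor m ⟩
    2 * ((suc m + 1) * (suc m + 2) * (suc m + 3) * ((3 + m + 1) * (3 + m + 2) * (3 + m + 3))) ∎

-- Permutations exchanging two adjacent blocks

-- Extending permutations by the identity beyond n spares every later statement its range conditions.
ext : Permutation′ n → ℕ → ℕ
ext {n} π x with x <? n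
... | yes x<n = toℕ (π ⟨$⟩ʳ fromℕ< x<n)
... | no  _   = x

ext-toℕ : (π : Permutation′ n) → ∀ i → ext π (toℕ i) ≡ toℕ (π ⟨$⟩ʳ i)
ext-toℕ {n} π i with toℕ i <? n
... | yes i<n = cong (toℕ ∘ (π ⟨$⟩ʳ_)) (fromℕ<-toℕ i i<n)
... | no  i≮n = ⊥-elim (i≮n (toℕ<n i))

ext-≥ : (π : Permutation′ n) → ∀ {x} → n ≤ x → ext π x ≡ x
ext-≥ {n} π {x} n≤x with x <? n
... | yes x<n = ⊥-elim (<⇒≱ x<n n≤x)
... | no  _   = refl

finOrBeyond : ∀ n {P : ℕ → Set ℓ} → (∀ (i : Fin n) → P (toℕ i)) → (∀ {x} → n ≤ x → P x) →
              ∀ x → P x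
finOrBeyond n {P = P} inside beyond x with <-≤-connex x n
... | inj₁ x<n = subst P (toℕ-fromℕ< x<n) (inside (fromℕ< x<n))
... | inj₂ n≤x = beyond n≤x

ext-inverse : (π : Permutation′ n) → ∀ x → ext (flip π) (ext π x) ≡ x
ext-inverse {n} π = finOrBeyond n
  (λ i → trans (cong (ext (flip π)) (ext-toℕ π i))
    (trans (ext-toℕ (flip π) (π ⟨$⟩ʳ i)) (cong toℕ (inverseˡ π))))
  (λ n≤x → trans (cong (ext (flip π)) (ext-≥ π n≤x)) (ext-≥ (flip π) n≤x))

ext-injective : (π : Permutation′ n) → ∀ {x y} → ext π x ≡ ext π y → x ≡ y
ext-injective π {x} {y} eq =
  trans (sym (ext-inverse π x)) (trans (cong (ext (flip π)) eq) (ext-inverse π y))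

ext-≗⇒≈ : (π ρ : Permutation′ n) → ext π ≗ ext ρ → π ≈ ρ
ext-≗⇒≈ π ρ eq i = toℕ-injective (trans (sym (ext-toℕ π i)) (trans (eq (toℕ i)) (ext-toℕ ρ i)))

-- In one-line notation f is 1⋯p (p+q+1)⋯(p+q+r) (p+1)⋯(p+q) (p+q+r+1)⋯; the fields count letters
-- and positions from 0.
record Block (p q r : ℕ) (f : ℕ → ℕ) : Set where
  field
    prefix : ∀ {x} → x < p → f x ≡ x
    upper  : ∀ {k} → k < r → f (p + k) ≡ p + (q + k)
    lower  : ∀ {k} → k < q → f (p + (r + k)) ≡ p + k
    suffix : ∀ k → f (p + (q + (r + k))) ≡ p + (q + (r + k))

-- The position is an index, so matching on a region rewrites it to the very form in which the
-- corresponding field of `Block` is stated.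
data Region (p q r : ℕ) : ℕ → Set where
  prefix : ∀ {x} → x < p → Region p q r x
  upper  : ∀ {k} → k < r → Region p q r (p + k)
  lower  : ∀ {k} → k < q → Region p q r (p + (r + k))
  suffix : ∀ k → Region p q r (p + (q + (r + k)))

+-left-comm : ∀ m n o → m + (n + o) ≡ n + (m + o)
+-left-comm m n o = trans (sym (+-assoc m n o)) (trans (cong (_+ o) (+-comm m n)) (+-assoc n m o))

region : ∀ p q r x → Region p q r x
region p q r x with <-≤-connex x p
... | inj₁ x<p = prefix x<p
... | inj₂ p≤x with k , refl ← m≤n⇒∃[o]m+o≡n p≤x with <-≤-connex k r
...   | inj₁ k<r = upper k<r
...   | inj₂ r≤k with l , refl ← m≤n⇒∃[o]m+o≡n r≤k with <-≤-connex l q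
...     | inj₁ l<q = lower l<q
...     | inj₂ q≤l with m , refl ← m≤n⇒∃[o]m+o≡n q≤l
          = subst (Region p q r) (cong (p +_) (+-left-comm q r m)) (suffix m)

Block-unique : ∀ {p q r f g} → Block p q r f → Block p q r g → f ≗ g
Block-unique {p} {q} {r} B C x with region p q r x
... | prefix x<p = trans (Block.prefix B x<p) (sym (Block.prefix C x<p))
... | upper k<r  = trans (Block.upper B k<r) (sym (Block.upper C k<r))
... | lower k<q  = trans (Block.lower B k<q) (sym (Block.lower C k<q))
... | suffix k   = trans (Block.suffix B k) (sym (Block.suffix C k))

Block-resp-≗ : ∀ {p q r f g} → f ≗ g → Block p q r f → Block p q r g
Block-resp-≗ f≗g B = record
  { prefix = λ x<p → trans (sym (f≗g _)) (Block.prefix B x<p)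
  ; upper  = λ k<r → trans (sym (f≗g _)) (Block.upper B k<r)
  ; lower  = λ k<q → trans (sym (f≗g _)) (Block.lower B k<q)
  ; suffix = λ k → trans (sym (f≗g _)) (Block.suffix B k)
  }

Block-inverse : ∀ {p q r f g} → (∀ x → g (f x) ≡ x) → Block p q r f → Block p r q g
Block-inverse {p} {q} {r} {f} {g} gf B = record
  { prefix = λ x<p → invert (Block.prefix B x<p)
  ; upper  = λ k<q → invert (Block.lower B k<q)
  ; lower  = λ k<r → invert (Block.upper B k<r)
  ; suffix = λ k → subst (λ x → g x ≡ x) (cong (p +_) (+-left-comm q r k)) (invert (Block.suffix B k))
  }
  where
  invert : ∀ {x y} → f x ≡ y → g y ≡ x
  invert refl = gf _

Block-bound : ∀ {p q r f} → Block p q r f → p + (q + r) ≤ n → ∀ {x} → x < n → f x < n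
Block-bound {n} {p} {q} {r} B c≤n {x} x<n with region p q r x
... | prefix x<p = subst (_< n) (sym (Block.prefix B x<p)) x<n
... | upper k<r  = subst (_< n) (sym (Block.upper B k<r))
  (<-≤-trans (+-monoʳ-< p (+-monoʳ-< q k<r)) c≤n)
... | lower k<q  = subst (_< n) (sym (Block.lower B k<q))
  (<-≤-trans (+-monoʳ-< p k<q) (≤-trans (+-monoʳ-≤ p (m≤m+n q r)) c≤n))
... | suffix k   = subst (_< n) (sym (Block.suffix B k)) x<n

module _ (p q r : ℕ) where

  -- Serves to show that the exchange exists; since `Block` determines its function by
  -- `Block-unique`, the later arguments work from the four equations.
  block : ℕ → ℕ
  block x = if does (x <? p) then x
            else if does (x <? p + r) then q + x
            else if does (x <? p + (r + q)) then x ∸ r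
            else x

  block-Block : Block p q r block
  block-Block = record
    { prefix = prefix′
    ; upper  = upper′
    ; lower  = lower′
    ; suffix = λ k → suffix′ (≤-trans (m≤m+n (q + r) k) (≤-reflexive (+-assoc q r k)))
    }
    where
    prefix′ : ∀ {x} → x < p → block x ≡ x
    prefix′ {x} x<p rewrite dec-true (x <? p) x<p = refl

    upper′ : ∀ {k} → k < r → block (p + k) ≡ p + (q + k)
    upper′ {k} k<r
      rewrite dec-false (p + k <? p) (≤⇒≯ (m≤m+n p k))
            | dec-true (p + k <? p + r) (+-monoʳ-< p k<r) = +-left-comm q p k

    lower′ : ∀ {k} → k < q → block (p + (r + k)) ≡ p + k
    lower′ {k} k<q
      rewrite dec-false (p + (r + k) <? p) (≤⇒≯ (m≤m+n p (r + k)))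
            | dec-false (p + (r + k) <? p + r) (≤⇒≯ (+-monoʳ-≤ p (m≤m+n r k)))
            | dec-true (p + (r + k) <? p + (r + q)) (+-monoʳ-< p (+-monoʳ-< r k<q))
            = trans (cong (_∸ r) (+-left-comm p r k)) (m+n∸m≡n r (p + k))

    suffix′ : ∀ {k} → q + r ≤ k → block (p + k) ≡ p + k
    suffix′ {k} q+r≤k
      rewrite dec-false (p + k <? p) (≤⇒≯ (m≤m+n p k))
            | dec-false (p + k <? p + r) (≤⇒≯ (+-monoʳ-≤ p (m+n≤o⇒n≤o q q+r≤k)))
            | dec-false (p + k <? p + (r + q))
                (≤⇒≯ (+-monoʳ-≤ p (subst (_≤ k) (+-comm q r) q+r≤k)))
            = refl

block-inverse : ∀ p q r x → block p r q (block p q r x) ≡ x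
block-inverse p q r x with region p q r x
... | prefix x<p = trans (cong (block p r q) (Block.prefix (block-Block p q r) x<p))
                         (Block.prefix (block-Block p r q) x<p)
... | upper k<r  = trans (cong (block p r q) (Block.upper (block-Block p q r) k<r))
                         (Block.lower (block-Block p r q) k<r)
... | lower k<q  = trans (cong (block p r q) (Block.lower (block-Block p q r) k<q))
                         (Block.upper (block-Block p r q) k<q)
... | suffix k   = trans (cong (block p r q) (Block.suffix (block-Block p q r) k))
  (subst (λ x → block p r q x ≡ x) (cong (p +_) (+-left-comm r q k)) (Block.suffix (block-Block p r q) k))

blockPermutation : ∀ p q r → p + (q + r) ≤ n → Permutation′ n
blockPermutation {n} p q r c≤n = permutation (to p q r c≤n) (to p r q c≤n′)
  (inverse p r q c≤n′ c≤n) (inverse p q r c≤n c≤n′)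
  where
  c≤n′ : p + (r + q) ≤ n
  c≤n′ = subst (λ x → p + x ≤ n) (+-comm q r) c≤n

  to : ∀ p q r → p + (q + r) ≤ n → Fin n → Fin n
  to p q r c≤n i = fromℕ< (Block-bound (block-Block p q r) c≤n (toℕ<n i))

  inverse : ∀ p q r c≤n c≤n′ i → to p r q c≤n′ (to p q r c≤n i) ≡ i
  inverse p q r _ _ i = toℕ-injective (trans (toℕ-fromℕ< _)
    (trans (cong (block p r q) (toℕ-fromℕ< _)) (block-inverse p q r (toℕ i))))

blockPermutation-Block : ∀ p q r (c≤n : p + (q + r) ≤ n) →
                         Block p q r (ext (blockPermutation p q r c≤n))
blockPermutation-Block {n} p q r c≤n = Block-resp-≗ (finOrBeyond n
  (λ i → sym (trans (ext-toℕ π i) (toℕ-fromℕ< _)))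
  (λ n≤x → trans (fixed (≤-trans c≤n n≤x)) (sym (ext-≥ π n≤x))))
  (block-Block p q r)
  where
  π : Permutation′ n
  π = blockPermutation p q r c≤n
  fixed : ∀ {x} → p + (q + r) ≤ x → block p q r x ≡ x
  fixed c≤x with k , refl ← m≤n⇒∃[o]m+o≡n c≤x
    = subst (λ x → block p q r x ≡ x)
        (sym (trans (+-assoc p (q + r) k) (cong (p +_) (+-assoc q r k))))
        (Block.suffix (block-Block p q r) k)

-- Bigrassmannian permutations exchange two adjacent blocks

-- `D` is where the second increasing run starts, so a descent at d corresponds to D = d + 1.
record IncreasingAround (D : ℕ) (f : ℕ → ℕ) : Set where
  field
    before : ∀ {x y} → x < y → y < D → f x < f y
    after  : ∀ {x y} → D ≤ x → x < y → f x < f y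

steps⇒increasingAround : ∀ {d f} → (∀ {x} → x ≢ d → f x < f (suc x)) → IncreasingAround (suc d) f
steps⇒increasingAround {d} {f} step = record
  { before = λ x<y y<D → chain (λ _ y≤d → step (<⇒≢ y≤d)) x<y (s≤s⁻¹ y<D)
  ; after  = λ D≤x x<y → chain {D = suc _} (λ x≤y _ → step (>⇒≢ (≤-trans D≤x x≤y))) x<y (n≤1+n _)
  }
  where
  chain : ∀ {x y D} → (∀ {z} → x ≤ z → z < D → f z < f (suc z)) → x < y → y ≤ D → f x < f y
  chain {x} {suc y} st (s≤s x≤y) y<D with m≤n⇒m<n∨m≡n x≤y
  ... | inj₁ x<y  = <-trans (chain st x<y (<⇒≤ y<D)) (st x≤y y<D)
  ... | inj₂ refl = st x≤y y<D

leastDisplaced : (f : ℕ → ℕ) → ∀ n → (∀ {x} → x < n → f x ≡ x) ⊎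
                 ∃ λ p → (∀ {x} → x < p → f x ≡ x) × f p ≢ p
leastDisplaced f zero = inj₁ λ ()
leastDisplaced f (suc n) with leastDisplaced f n
... | inj₂ found = inj₂ found
... | inj₁ fixed with f n ≟ n
...   | no  displaced = inj₂ (n , fixed , displaced)
...   | yes fn≡n = inj₁ λ { (s≤s x≤n) → [ fixed , (λ { refl → fn≡n }) ]′ (m≤n⇒m<n∨m≡n x≤n) }

Descentℕ : (ℕ → ℕ) → ℕ → Set
Descentℕ f x = f (suc x) < f x

-- Extending by the identity creates no descent: the last letter of `π` is below n, the next value
-- of the extension. Injectivity turns every other non-descent into an ascent.
uniqueDescent⁻ : (π : Permutation′ n) → HasUniqueDescent π →
                 ∃ λ d → Descentℕ (ext π) d × IncreasingAround (suc d) (ext π)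
uniqueDescent⁻ {n} π (i , (j , j≡1+i , πj<πi) , unique) =
  toℕ i ,
  subst₂ _<_ (trans (sym (ext-toℕ π j)) (cong (ext π) j≡1+i)) (sym (ext-toℕ π i)) πj<πi ,
  steps⇒increasingAround ascent
  where
  unique′ : ∀ x → Descentℕ (ext π) x → x ≡ toℕ i
  unique′ = finOrBeyond n inside beyond
    where
    beyond : ∀ {x} → n ≤ x → Descentℕ (ext π) x → x ≡ toℕ i
    beyond {x} n≤x desc = ⊥-elim (<-asym desc
      (subst₂ _<_ (sym (ext-≥ π n≤x)) (sym (ext-≥ π (m≤n⇒m≤1+n n≤x))) (n<1+n x)))

    inside : ∀ k → Descentℕ (ext π) (toℕ k) → toℕ k ≡ toℕ i
    inside k desc with <-≤-connex (suc (toℕ k)) n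
    ... | inj₂ n≤1+k = ⊥-elim (<-asym desc
      (subst₂ _<_ (sym (ext-toℕ π k)) (sym (ext-≥ π n≤1+k)) (<-≤-trans (toℕ<n (π ⟨$⟩ʳ k)) n≤1+k)))
    ... | inj₁ 1+k<n = cong toℕ (sym (unique (fromℕ< 1+k<n , toℕ-fromℕ< 1+k<n ,
      subst₂ _<_ (trans (cong (ext π) (sym (toℕ-fromℕ< 1+k<n))) (ext-toℕ π _)) (ext-toℕ π k) desc)))

  ascent : ∀ {x} → x ≢ toℕ i → ext π x < ext π (suc x)
  ascent {x} x≢d with <-cmp (ext π x) (ext π (suc x))
  ... | tri< lt _ _ = lt
  ... | tri≈ _ eq _ = ⊥-elim (1+n≢n (sym (ext-injective π eq)))
  ... | tri> _ _ gt = ⊥-elim (x≢d (unique′ x gt))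

uniqueDescent⁺ : (π : Permutation′ n) → ∀ {d} → Descentℕ (ext π) d → suc d < n →
                 (∀ {x} → Descentℕ (ext π) x → x ≡ d) → HasUniqueDescent π
uniqueDescent⁺ {n} π {d} desc 1+d<n unique =
  fromℕ< d<n ,
  (fromℕ< 1+d<n , trans (toℕ-fromℕ< 1+d<n) (cong suc (sym (toℕ-fromℕ< d<n))) ,
   subst₂ _<_ (value 1+d<n) (value d<n) desc) ,
  λ { {k} (j , j≡1+k , πj<πk) → toℕ-injective (trans (toℕ-fromℕ< d<n) (sym (unique
      (subst₂ _<_ (trans (sym (ext-toℕ π j)) (cong (ext π) j≡1+k)) (sym (ext-toℕ π k)) πj<πk)))) }
  where
  d<n : d < n
  d<n = <-trans (n<1+n d) 1+d<n
  value : ∀ {x} (x<n : x < n) → ext π x ≡ toℕ (π ⟨$⟩ʳ fromℕ< x<n)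
  value x<n = trans (cong (ext π) (sym (toℕ-fromℕ< x<n))) (ext-toℕ π (fromℕ< x<n))

-- The drop is at the last position p + r of the upper block, where the letter p + q + r + 1 is
-- followed by p. At the other two seams, from the prefix to the upper block and from the lower
-- block to the suffix, the letters rise.
Block⇒uniqueDescent : ∀ {p q r} (π : Permutation′ n) → Block p (suc q) (suc r) (ext π) →
                      p + (suc q + suc r) ≤ n → HasUniqueDescent π
Block⇒uniqueDescent {n} {p} {q} {r} π B c≤n = uniqueDescent⁺ π descent
  (≤-trans (≤-reflexive bound) (≤-trans (+-monoʳ-≤ p (s≤s (m≤n+m (suc r) q))) c≤n))
  (λ {x} → unique (region p (suc q) (suc r) x))
  where
  f = ext π
  open Block B using () renaming (prefix to pre; upper to upp; lower to low; suffix to suf)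

  bound : suc (suc (p + r)) ≡ p + suc (suc r)
  bound = sym (trans (+-suc p (suc r)) (cong suc (+-suc p r)))

  descent : Descentℕ f (p + r)
  descent = subst₂ _<_
    (sym (trans (cong f (trans (sym (+-suc p r)) (cong (p +_) (sym (+-identityʳ (suc r)))))) (low z<s)))
    (sym (upp (n<1+n r)))
    (+-monoʳ-< p z<s)

  ascent : ∀ {x y z} → f x ≡ y → f (suc x) ≡ z → y < z → ¬ Descentℕ f x
  ascent refl refl y<z = <-asym y<z

  unique : ∀ {x} → Region p (suc q) (suc r) x → Descentℕ f x → x ≡ p + r
  unique (prefix {x} x<p) desc with m≤n⇒m<n∨m≡n x<p
  ... | inj₁ 1+x<p = ⊥-elim (ascent (pre x<p) (pre 1+x<p) (n<1+n x) desc)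
  ... | inj₂ refl  = ⊥-elim (ascent (pre x<p)
    (trans (cong f (sym (+-identityʳ (suc x)))) (upp z<s)) (s≤s (m≤m+n x _)) desc)
  unique (upper {k} (s≤s k≤r)) desc with m≤n⇒m<n∨m≡n k≤r
  ... | inj₂ refl = refl
  ... | inj₁ k<r  = ⊥-elim (ascent (upp (s≤s k≤r))
    (trans (cong f (sym (+-suc p k))) (upp (s≤s k<r))) (+-monoʳ-< p (+-monoʳ-< (suc q) (n<1+n k))) desc)
  unique (lower {k} k<q@(s≤s k≤q)) desc with m≤n⇒m<n∨m≡n k≤q
  ... | inj₁ 1+k≤q = ⊥-elim (ascent (low k<q)
    (trans (cong f (sym (trans (cong (p +_) (+-suc (suc r) k)) (+-suc p _)))) (low (s≤s 1+k≤q)))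
    (+-monoʳ-< p (n<1+n k)) desc)
  ... | inj₂ refl = ⊥-elim (ascent (low k<q)
    (trans (cong f (trans (sym (+-suc p _)) (cong (λ z → p + suc z)
      (trans (sym (+-suc r k)) (trans (+-comm r (suc k)) (cong (suc k +_) (sym (+-identityʳ r))))))))
      (trans (cong f (cong (p +_) (sym (+-suc (suc k) (r + 0))))) (suf 0)))
    (+-monoʳ-< p (m≤m+n (suc k) _)) desc)
  unique (suffix k) desc = ⊥-elim (ascent (suf k) (trans (cong f next) (suf (suc k)))
    (+-monoʳ-< p (+-monoʳ-< (suc q) (+-monoʳ-< (suc r) (n<1+n k)))) desc)
    where
    next : suc (p + (suc q + (suc r + k))) ≡ p + (suc q + (suc r + suc k))
    next = sym (trans (cong (λ z → p + (suc q + z)) (+-suc (suc r) k))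
      (trans (cong (p +_) (+-suc (suc q) _)) (+-suc p _)))

Block⇒bigrassmannian : ∀ {p q r} (π : Permutation′ n) → Block p (suc q) (suc r) (ext π) →
                       p + (suc q + suc r) ≤ n → Bigrassmannian π
Block⇒bigrassmannian {n} {p} {q} {r} π B c≤n =
  Block⇒uniqueDescent π B c≤n ,
  Block⇒uniqueDescent (flip π) (Block-inverse (ext-inverse π) B)
    (subst (λ x → p + x ≤ n) (+-comm (suc q) (suc r)) c≤n)

module _ {f g : ℕ → ℕ} (gf : ∀ x → g (f x) ≡ x) (fg : ∀ x → f (g x) ≡ x) where

  inverse-fixes : ∀ {p} → (∀ {x} → x < p → f x ≡ x) → ∀ {x} → x < p → g x ≡ x
  inverse-fixes fix {x} x<p = trans (cong g (sym (fix x<p))) (gf x)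

  -- The letters below p are used up by the positions below p.
  fixed-below⇒≥ : ∀ {p} → (∀ {x} → x < p → f x ≡ x) → ∀ {x} → p ≤ x → p ≤ f x
  fixed-below⇒≥ {p} fix {x} p≤x with <-≤-connex (f x) p
  ... | inj₂ p≤fx = p≤fx
  ... | inj₁ fx<p = ⊥-elim (<⇒≱ fx<p
    (subst (p ≤_) (trans (sym (gf x)) (inverse-fixes fix fx<p)) p≤x))

  -- The position of p is beyond p, where the letters are at least p, so it starts an increasing run.
  preimage-of-leastDisplaced : ∀ {D p} → IncreasingAround D f →
    (∀ {x} → x < p → f x ≡ x) → p < f p → p < g p → p < D × g p ≡ D
  preimage-of-leastDisplaced {D} {p} inc fix p<fp p<gp = p<D , ≤-antisym gp≤D D≤gp
    where
    open IncreasingAround inc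
    p<D : p < D
    p<D with <-≤-connex p D
    ... | inj₁ p<D = p<D
    ... | inj₂ D≤p = ⊥-elim (<-asym p<fp (subst (f p <_) (fg p) (after D≤p p<gp)))

    D≤gp : D ≤ g p
    D≤gp with <-≤-connex (g p) D
    ... | inj₂ D≤gp = D≤gp
    ... | inj₁ gp<D = ⊥-elim (<-asym p<fp (subst (f p <_) (fg p) (before p<gp gp<D)))

    gp≤D : g p ≤ D
    gp≤D with <-≤-connex D (g p)
    ... | inj₂ gp≤D = gp≤D
    ... | inj₁ D<gp = ⊥-elim (<⇒≱ (subst (f D <_) (fg p) (after ≤-refl D<gp))
      (fixed-below⇒≥ fix (<⇒≤ p<D)))

  -- The letters p, …, E - 1 occur in increasing order from position D on, and no letter after
  -- position D can fall between two consecutive ones.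
  run : ∀ {D E p} → IncreasingAround D f → IncreasingAround E g → f D ≡ p →
        ∀ k → p + k < E → f (D + k) ≡ p + k
  run {D} {E} {p} incf incg fD zero    _ = trans (cong f (+-identityʳ D)) (trans fD (sym (+-identityʳ p)))
  run {D} {E} {p} incf incg fD (suc k) p+1+k<E = trans (cong f (≤-antisym D+1+k≤gy (≮⇒≥ ¬gap))) (fg y)
    where
    y = p + suc k
    p+k<y : p + k < y
    p+k<y = +-monoʳ-< p (n<1+n k)
    ih : f (D + k) ≡ p + k
    ih = run incf incg fD k (<-trans p+k<y p+1+k<E)
    D+k<gy : D + k < g y
    D+k<gy = subst (_< g y) (trans (cong g (sym ih)) (gf (D + k)))
      (IncreasingAround.before incg p+k<y p+1+k<E)
    D+1+k≤gy : D + suc k ≤ g y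
    D+1+k≤gy = subst (_≤ g y) (sym (+-suc D k)) D+k<gy
    ¬gap : ¬ (D + suc k < g y)
    ¬gap gap = <⇒≱ fD+1+k<y (subst (_≤ f (D + suc k)) (sym (+-suc p k))
      (subst (_< f (D + suc k)) ih (IncreasingAround.after incf (m≤m+n D k) (+-monoʳ-< D (n<1+n k)))))
      where
      fD+1+k<y : f (D + suc k) < y
      fD+1+k<y = subst (f (D + suc k) <_) (fg y) (IncreasingAround.after incf (m≤m+n D (suc k)) gap)

inflationary-beyond : ∀ {D c} {f : ℕ → ℕ} → IncreasingAround D f → D ≤ c → c ≤ f c →
                      ∀ k → c + k ≤ f (c + k)
inflationary-beyond {D} {c} {f} inc D≤c c≤fc zero =
  subst (λ x → x ≤ f x) (sym (+-identityʳ c)) c≤fc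
inflationary-beyond {D} {c} {f} inc D≤c c≤fc (suc k) = subst (_≤ f (c + suc k)) (sym (+-suc c k))
  (≤-<-trans (inflationary-beyond inc D≤c c≤fc k)
    (IncreasingAround.after inc (≤-trans D≤c (m≤m+n c k)) (+-monoʳ-< c (n<1+n k))))

≤-beyond : ∀ {c} {f g : ℕ → ℕ} → (∀ x → g (f x) ≡ x) → (∀ {y} → y < c → g y < c) → c ≤ f c
≤-beyond {c} {f} gf g< = ≮⇒≥ λ fc<c → <-irrefl (gf c) (g< fc<c)

-- With p the least displaced point of `f`, and hence of `g`, the second runs start at `D = g p` and
-- `E = f p`; these distances from p are the block sizes. Consecutive letters from position D on
-- give the lower block of `f`, and the same argument for `g` gives the upper block after inversion.
-- Both maps preserve the range below the end c of the blocks, which forces them to be the identity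
-- from c on.
increasingAround⇒Block : ∀ {f g : ℕ → ℕ} → (∀ x → g (f x) ≡ x) → (∀ x → f (g x) ≡ x) →
  ∀ {d E} → IncreasingAround (suc d) f → IncreasingAround E g → Descentℕ f d →
  ∃ λ p → ∃₂ λ q r → Block p (suc q) (suc r) f
increasingAround⇒Block {f} {g} gf fg {d} {E} incf incg desc with leastDisplaced f (2 + d)
-- The descent at d displaces d or d + 1, so the search below 2 + d cannot fail.
... | inj₁ fixed = ⊥-elim (<-asym (n<1+n d)
        (subst₂ _<_ (fixed (n<1+n (suc d))) (fixed (m≤n⇒m≤1+n (n<1+n d))) desc))
... | inj₂ (p , fixed , fp≢p)
  with p<fp ← ≤∧≢⇒< (fixed-below⇒≥ gf fg fixed ≤-refl) (≢-sym fp≢p)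
  with p<gp ← ≤∧≢⇒< (fixed-below⇒≥ fg gf (inverse-fixes gf fg fixed) ≤-refl)
                    (λ p≡gp → fp≢p (trans (cong f p≡gp) (fg p)))
  with p<D , gp≡D ← preimage-of-leastDisplaced gf fg incf fixed p<fp p<gp
     | p<E , fp≡E ← preimage-of-leastDisplaced fg gf incg (inverse-fixes gf fg fixed) p<gp p<fp
  with r , D≡ ← m≤n⇒∃[o]m+o≡n p<D | q , E≡ ← m≤n⇒∃[o]m+o≡n p<E
  = p , q , r , record { prefix = fixed ; upper = upp ; lower = low ; suffix = suf }
  where
  D = suc d
  fD≡p : f D ≡ p
  fD≡p = trans (cong f (sym gp≡D)) (fg p)
  gE≡p : g E ≡ p
  gE≡p = trans (cong g (sym fp≡E)) (gf p)
  D≡p+1+r : p + suc r ≡ D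
  D≡p+1+r = trans (+-suc p r) D≡
  E≡p+1+q : p + suc q ≡ E
  E≡p+1+q = trans (+-suc p q) E≡

  low : ∀ {k} → k < suc q → f (p + (suc r + k)) ≡ p + k
  low {k} k<1+q = trans (cong f (trans (sym (+-assoc p (suc r) k)) (cong (_+ k) D≡p+1+r)))
    (run gf fg incf incg fD≡p k (subst (p + k <_) E≡p+1+q (+-monoʳ-< p k<1+q)))

  upp⁻ : ∀ {k} → k < suc r → g (p + (suc q + k)) ≡ p + k
  upp⁻ {k} k<1+r = trans (cong g (trans (sym (+-assoc p (suc q) k)) (cong (_+ k) E≡p+1+q)))
    (run fg gf incg incf gE≡p k (subst (p + k <_) D≡p+1+r (+-monoʳ-< p k<1+r)))

  flipped : ∀ {f g : ℕ → ℕ} {x y} → (∀ z → f (g z) ≡ z) → g y ≡ x → f x ≡ y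
  flipped fg refl = fg _

  upp : ∀ {k} → k < suc r → f (p + k) ≡ p + (suc q + k)
  upp k<1+r = flipped {f = f} {g} fg (upp⁻ k<1+r)

  low⁻ : ∀ {k} → k < suc q → g (p + k) ≡ p + (suc r + k)
  low⁻ k<1+q = flipped {f = g} {f} gf (low k<1+q)

  c = p + (suc q + suc r)

  closed : ∀ {f : ℕ → ℕ} q r → (∀ {x} → x < p → f x ≡ x) →
           (∀ {k} → k < r → f (p + k) ≡ p + (q + k)) →
          (∀ {k} → k < q → f (p + (r + k)) ≡ p + k) → ∀ {x} → x < p + (q + r) → f x < p + (q + r)
  closed q r fix upp low {x} x<c with region p q r x
  ... | prefix x<p = subst (_< _) (sym (fix x<p)) x<c
  ... | upper k<r  = subst (_< _) (sym (upp k<r)) (+-monoʳ-< p (+-monoʳ-< q k<r))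
  ... | lower k<q  = subst (_< _) (sym (low k<q)) (+-monoʳ-< p (<-≤-trans k<q (m≤m+n q r)))
  ... | suffix k   = ⊥-elim (<⇒≱ x<c (+-monoʳ-≤ p (+-monoʳ-≤ q (m≤m+n r k))))

  f< : ∀ {x} → x < c → f x < c
  f< = closed (suc q) (suc r) fixed upp low

  g< : ∀ {x} → x < c → g x < c
  g< {x} x<c = subst (g x <_) (cong (p +_) (+-comm (suc r) (suc q)))
    (closed (suc r) (suc q) (inverse-fixes gf fg fixed) low⁻ upp⁻
      (subst (x <_) (cong (p +_) (+-comm (suc q) (suc r))) x<c))

  D≤c : D ≤ c
  D≤c = subst (_≤ c) D≡p+1+r (+-monoʳ-≤ p (m≤n+m (suc r) (suc q)))
  E≤c : E ≤ c
  E≤c = subst (_≤ c) E≡p+1+q (+-monoʳ-≤ p (m≤m+n (suc q) (suc r)))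

  c+k≤ : ∀ k → c + k ≤ f (c + k)
  c+k≤ = inflationary-beyond incf D≤c (≤-beyond gf g<)

  fixed-beyond : ∀ k → f (c + k) ≡ c + k
  -- Neither `f` nor `g` lowers a point from c on. Applying this to `g` at `f (c + k)` gives
  -- `f (c + k) ≤ g (f (c + k))`, which is `c + k`.
  fixed-beyond k with l , eq ← m≤n⇒∃[o]m+o≡n (≤-trans (m≤m+n c k) (c+k≤ k)) = ≤-antisym
    (≤-trans (≤-reflexive (sym eq))
      (≤-trans (inflationary-beyond incg E≤c (≤-beyond fg f<) l)
        (≤-reflexive (trans (cong g eq) (gf (c + k))))))
    (c+k≤ k)

  suf : ∀ k → f (p + (suc q + (suc r + k))) ≡ p + (suc q + (suc r + k))
  suf k = subst (λ x → f x ≡ x)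
    (trans (+-assoc p (suc q + suc r) k) (cong (p +_) (+-assoc (suc q) (suc r) k)))
    (fixed-beyond k)

-- An extended permutation fixes every point beyond n, but a block moves the last point before its
-- end p + q + r + 2.
Block-fits : ∀ {p q r} (π : Permutation′ n) → Block p (suc q) (suc r) (ext π) → p + (suc q + suc r) ≤ n
Block-fits {n} {p} {q} {r} π B = ≮⇒≥ λ n<c → <-irrefl
  (trans (sym (Block.lower B (n<1+n q))) (ext-≥ π (last≥n n<c)))
  (+-monoʳ-< p (m<n+m q z<s))
  where
  last≥n : n < p + (suc q + suc r) → n ≤ p + (suc r + q)
  last≥n n<c = s≤s⁻¹ (subst (suc n ≤_) (trans (cong (p +_)
    (cong suc (+-comm q (suc r)))) (+-suc p _)) n<c)

bigrassmannian⇒Block : (π : Permutation′ n) → Bigrassmannian π →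
  ∃ λ p → ∃₂ λ q r → Block p (suc q) (suc r) (ext π) × p + (suc q + suc r) ≤ n
bigrassmannian⇒Block π (uf , ug)
  with d , desc , incf ← uniqueDescent⁻ π uf | e , _ , incg ← uniqueDescent⁻ (flip π) ug
  with p , q , r , B ← increasingAround⇒Block (ext-inverse π) (ext-inverse (flip π)) incf incg desc
  = p , q , r , B , Block-fits π B

-- The Bruhat order between bigrassmannian permutations

≤ᴮ-respʳ-≈ : {π σ τ : Permutation′ n} → σ ≈ τ → π ≤ᴮ σ → π ≤ᴮ τ
≤ᴮ-respʳ-≈ σ≈τ (done π≈σ) = done λ i → trans (π≈σ i) (σ≈τ i)
≤ᴮ-respʳ-≈ {σ = σ} {τ} σ≈τ (reduce i j i<j σj<σi π≤) =
  reduce i j i<j (subst₂ Fin._<_ (σ≈τ j) (σ≈τ i) σj<σi)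
    (≤ᴮ-respʳ-≈ {σ = transpose i j ∘ₚ σ} {transpose i j ∘ₚ τ} (λ k → σ≈τ (transpose i j ⟨$⟩ʳ k)) π≤)

≤ᴮ-trans : {π ρ σ : Permutation′ n} → π ≤ᴮ ρ → ρ ≤ᴮ σ → π ≤ᴮ σ
≤ᴮ-trans {ρ = ρ} {σ} π≤ρ (done ρ≈σ)                = ≤ᴮ-respʳ-≈ {σ = ρ} {σ} ρ≈σ π≤ρ
≤ᴮ-trans π≤ρ (reduce i j i<j σj<σi ρ≤) = reduce i j i<j σj<σi (≤ᴮ-trans π≤ρ ρ≤)

transpose-elim : ∀ {ℓ} (P : Fin n → Fin n → Set ℓ) i j → P i j → P j i →
                 (∀ {k} → k ≢ i → k ≢ j → P k k) → ∀ k → P k (transpose i j ⟨$⟩ʳ k)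
transpose-elim P i j first second other k with k Fin.≟ i
... | yes refl = first
... | no  k≢i with k Fin.≟ j
...   | yes refl = second
...   | no  k≢j  = other k≢i k≢j

-- A reduction at i < j puts at i a letter smaller than the one already bounded by `h i`, and takes
-- that letter to j, where the bound is no smaller.
≤ᴮ-upperBound : {π σ : Permutation′ n} {h : ℕ → ℕ} → (∀ {x y} → x ≤ y → h x ≤ h y) → π ≤ᴮ σ →
                (∀ i → toℕ (σ ⟨$⟩ʳ i) ≤ h (toℕ i)) → ∀ i → toℕ (π ⟨$⟩ʳ i) ≤ h (toℕ i)
≤ᴮ-upperBound {h = h} mono (done π≈σ) σ≤h i =
  subst (λ k → toℕ k ≤ h (toℕ i)) (sym (π≈σ i)) (σ≤h i)
≤ᴮ-upperBound {σ = σ} {h} mono (reduce i j i<j σj<σi π≤) σ≤h = ≤ᴮ-upperBound {h = h} mono π≤ bound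
  where
  bound : ∀ k → toℕ (σ ⟨$⟩ʳ (transpose i j ⟨$⟩ʳ k)) ≤ h (toℕ k)
  bound = transpose-elim (λ k l → toℕ (σ ⟨$⟩ʳ l) ≤ h (toℕ k)) i j
    (≤-trans (<⇒≤ σj<σi) (σ≤h i)) (≤-trans (σ≤h i) (mono (<⇒≤ i<j))) (λ _ _ → σ≤h _)

-- Dually, the letter of j moves to i, where the bound is no larger, and j receives a larger letter.
≤ᴮ-lowerBound : {π σ : Permutation′ n} {h : ℕ → ℕ} → (∀ {x y} → x ≤ y → h x ≤ h y) → π ≤ᴮ σ →
                (∀ i → h (toℕ i) ≤ toℕ (σ ⟨$⟩ʳ i)) → ∀ i → h (toℕ i) ≤ toℕ (π ⟨$⟩ʳ i)
≤ᴮ-lowerBound {h = h} mono (done π≈σ) h≤σ i =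
  subst (λ k → h (toℕ i) ≤ toℕ k) (sym (π≈σ i)) (h≤σ i)
≤ᴮ-lowerBound {σ = σ} {h} mono (reduce i j i<j σj<σi π≤) h≤σ = ≤ᴮ-lowerBound {h = h} mono π≤ bound
  where
  bound : ∀ k → h (toℕ k) ≤ toℕ (σ ⟨$⟩ʳ (transpose i j ⟨$⟩ʳ k))
  bound = transpose-elim (λ k l → h (toℕ k) ≤ toℕ (σ ⟨$⟩ʳ l)) i j
    (≤-trans (mono (<⇒≤ i<j)) (h≤σ j)) (≤-trans (h≤σ j) (<⇒≤ σj<σi)) (λ _ _ → h≤σ _)

ext-upperBound : {π σ : Permutation′ n} {h : ℕ → ℕ} → (∀ {x y} → x ≤ y → h x ≤ h y) → π ≤ᴮ σ →
                 (∀ x → ext σ x ≤ h x) → ∀ {x} → x < n → ext π x ≤ h x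
ext-upperBound {π = π} {σ} {h} mono π≤σ σ≤h x<n =
  subst (λ x → ext π x ≤ h x) (toℕ-fromℕ< x<n)
    (≤-trans (≤-reflexive (ext-toℕ π _)) (≤ᴮ-upperBound {h = h} mono π≤σ
      (λ i → ≤-trans (≤-reflexive (sym (ext-toℕ σ i))) (σ≤h (toℕ i))) (fromℕ< x<n)))

ext-lowerBound : {π σ : Permutation′ n} {h : ℕ → ℕ} → (∀ {x y} → x ≤ y → h x ≤ h y) → π ≤ᴮ σ →
                 (∀ x → h x ≤ ext σ x) → ∀ {x} → x < n → h x ≤ ext π x
ext-lowerBound {π = π} {σ} {h} mono π≤σ h≤σ x<n =
  subst (λ x → h x ≤ ext π x) (toℕ-fromℕ< x<n)
    (≤-trans (≤ᴮ-lowerBound {h = h} mono π≤σ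
      (λ i → ≤-trans (h≤σ (toℕ i)) (≤-reflexive (ext-toℕ σ i))) (fromℕ< x<n))
      (≤-reflexive (sym (ext-toℕ π _))))

module _ {p q r : ℕ} {f : ℕ → ℕ} (B : Block p q r f) where

  Block-≤-+ : ∀ x → f x ≤ x + q
  Block-≤-+ x with region p q r x
  ... | prefix x<p    = ≤-trans (≤-reflexive (Block.prefix B x<p)) (m≤m+n _ q)
  ... | upper {k} k<r = ≤-reflexive (trans (Block.upper B k<r)
    (trans (cong (p +_) (+-comm q k)) (sym (+-assoc p k q))))
  ... | lower {k} k<q = ≤-trans (≤-reflexive (Block.lower B k<q))
    (≤-trans (+-monoʳ-≤ p (m≤n+m k r)) (m≤m+n _ q))
  ... | suffix k      = ≤-trans (≤-reflexive (Block.suffix B k)) (m≤m+n _ q)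

  Block-∸-≤ : ∀ x → x ∸ r ≤ f x
  Block-∸-≤ x = m≤n+o⇒m∸n≤o x r (bound (region p q r x))
    where
    bound : ∀ {x} → Region p q r x → x ≤ r + f x
    bound (prefix x<p)    = ≤-trans (≤-reflexive (sym (Block.prefix B x<p))) (m≤n+m _ r)
    bound (upper {k} k<r) = ≤-trans (+-monoʳ-≤ p (m≤n+m k q))
      (≤-trans (≤-reflexive (sym (Block.upper B k<r))) (m≤n+m _ r))
    bound (lower {k} k<q) = ≤-reflexive (trans (+-left-comm p r k) (cong (r +_) (sym (Block.lower B k<q))))
    bound (suffix k)      = ≤-trans (≤-reflexive (sym (Block.suffix B k))) (m≤n+m _ r)

  Block-⊓-≤ : ∀ x → x ⊓ p ≤ f x
  Block-⊓-≤ x with region p q r x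
  ... | prefix x<p    = ≤-trans (m⊓n≤m _ p) (≤-reflexive (sym (Block.prefix B x<p)))
  ... | upper {k} k<r = ≤-trans (m⊓n≤n (p + k) p)
    (≤-trans (m≤m+n p _) (≤-reflexive (sym (Block.upper B k<r))))
  ... | lower {k} k<q = ≤-trans (m⊓n≤n (p + (r + k)) p)
    (≤-trans (m≤m+n p _) (≤-reflexive (sym (Block.lower B k<q))))
  ... | suffix k      = ≤-trans (m⊓n≤m _ p) (≤-reflexive (sym (Block.suffix B k)))

  -- Only letters of the upper block exceed their position, and they stay below the end of the
  -- blocks; `suc c` appears because positions count from 0.
  Block-<-⊔ : ∀ {c} → p + (q + r) ≤ suc c → ∀ x → f x ≤ x ⊔ c
  Block-<-⊔ {c} c≤ x with region p q r x
  ... | prefix x<p    = ≤-trans (≤-reflexive (Block.prefix B x<p)) (m≤m⊔n _ c)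
  ... | upper {k} k<r = ≤-trans (≤-reflexive (Block.upper B k<r))
    (≤-trans (s≤s⁻¹ (≤-trans (+-monoʳ-< p (+-monoʳ-< q k<r)) c≤)) (m≤n⊔m _ c))
  ... | lower {k} k<q = ≤-trans (≤-reflexive (Block.lower B k<q))
    (≤-trans (+-monoʳ-≤ p (m≤n+m k r)) (m≤m⊔n _ c))
  ... | suffix k      = ≤-trans (≤-reflexive (Block.suffix B k)) (m≤m⊔n _ c)

-- The code (p , q , r , s) stands for the bigrassmannian permutation of n = p + (q + 1) + (r + 1) + s
-- with a = p, b = p + q + 1 and c = n - s.
Encodes : Permutation′ n → Code → Set
Encodes {n} π v@(p ∷ q ∷ r ∷ s ∷ []) = Block p (suc q) (suc r) (ext π) × 2 + sum v ≡ n

private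
  size-sum : ∀ p q r s → p + (suc q + suc r) + s ≡ 2 + (p + (q + (r + (s + 0))))
  size-sum = solve-∀

Encodes-size : ∀ {p q r s} → 2 + (p + (q + (r + (s + 0)))) ≡ n → p + (suc q + suc r) + s ≡ n
Encodes-size {p = p} {q} {r} {s} eq = trans (size-sum p q r s) eq

-- Each bound satisfied by `σ` is tested where `π` is extreme: position p with letter p + q + 1
-- gives q, position p + r + 1 with letter p gives both r and p, and position p + r with letter p +
-- q + r + 1 compares the ends of the blocks, which gives s because the totals agree.
≤ᴮ⇒≼ : {π σ : Permutation′ n} → ∀ {v w} → Encodes π v → Encodes σ w → π ≤ᴮ σ → v ≼ w
≤ᴮ⇒≼ {n} {π} {σ} {p ∷ q ∷ r ∷ s ∷ []} {p′ ∷ q′ ∷ r′ ∷ s′ ∷ []} (B , eq) (B′ , eq′) π≤σ =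
  (p′≤p , s′≤s) , q≤q′ , r≤r′
  where
  f = ext π
  size : p + (suc q + suc r) + s ≡ n
  size = Encodes-size {p = p} {q} {r} eq
  size′ : p′ + (suc q′ + suc r′) + s′ ≡ n
  size′ = Encodes-size {p = p′} {q′} {r′} eq′
  <n : ∀ {x} → x < p + (suc q + suc r) → x < n
  <n x<c = <-≤-trans x<c (≤-trans (m≤m+n _ s) (≤-reflexive size))
  low0 : f (p + suc r) ≡ p
  low0 = trans (cong (λ k → f (p + k)) (sym (+-identityʳ (suc r))))
    (trans (Block.lower B z<s) (+-identityʳ p))
  low0<n : p + suc r < n
  low0<n = <n (+-monoʳ-< p (m<n+m (suc r) z<s))

  q≤q′ : q ≤ q′
  q≤q′ = s≤s⁻¹ (+-cancelˡ-≤ p (suc q) (suc q′) (subst (_≤ p + suc q′) (trans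
    (cong f (sym (+-identityʳ p))) (trans (Block.upper B z<s) (cong (p +_) (+-identityʳ (suc q)))))
    (ext-upperBound {π = π} {σ} {h = _+ suc q′} (+-monoˡ-≤ (suc q′)) π≤σ (Block-≤-+ B′) (<n (m<m+n p z<s)))))

  r≤r′ : r ≤ r′
  r≤r′ = s≤s⁻¹ (+-cancelˡ-≤ p (suc r) (suc r′) (≤-trans (m≤n+m∸n (p + suc r) (suc r′))
    (≤-trans (+-monoʳ-≤ (suc r′) (subst (p + suc r ∸ suc r′ ≤_) low0
      (ext-lowerBound {π = π} {σ} {h = _∸ suc r′} (∸-monoˡ-≤ (suc r′)) π≤σ (Block-∸-≤ B′) low0<n)))
    (≤-reflexive (+-comm (suc r′) p)))))

  p′≤p : p′ ≤ p
  p′≤p = ≮⇒≥ λ p<p′ → <⇒≱ (⊓-pres-m< (m<m+n p z<s) p<p′) (subst ((p + suc r) ⊓ p′ ≤_) low0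
    (ext-lowerBound {π = π} {σ} {h = _⊓ p′} (⊓-monoˡ-≤ p′) π≤σ (Block-⊓-≤ B′) low0<n))

  c′-1 = p′ + (suc q′ + r′)

  c≤c′ : p + (suc q + r) ≤ c′-1
  c≤c′ = ≮⇒≥ λ c′<c → <⇒≱ (⊔-pres-<m (+-monoʳ-< p (m<n+m r z<s)) c′<c)
    (subst (_≤ (p + r) ⊔ c′-1) (Block.upper B (n<1+n r))
      (ext-upperBound {π = π} {σ} {h = _⊔ c′-1} (⊔-monoˡ-≤ c′-1) π≤σ
        (Block-<-⊔ B′ (≤-reflexive (trans (cong (p′ +_) (+-suc (suc q′) r′)) (+-suc p′ _))))
        (<n (+-monoʳ-< p (m≤n+m (suc r) (suc q))))))

  s′≤s : s′ ≤ s
  s′≤s = +-cancelˡ-≤ (suc c′-1) s′ s (≤-trans (≤-reflexive (trans (shift p′ q′ r′ s′)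
    (trans size′ (trans (sym size) (sym (shift p q r s)))))) (+-monoˡ-≤ s (s≤s c≤c′)))
    where
    shift : ∀ p q r s → suc (p + (suc q + r)) + s ≡ p + (suc q + suc r) + s
    shift = solve-∀

-- Sequences of reductions that realise the four moves

ext-reduce : (σ : Permutation′ n) → ∀ {i j} → i < j → ext σ j < ext σ i →
  ∃ λ σ′ → ext σ′ i ≡ ext σ j × ext σ′ j ≡ ext σ i ×
           (∀ {x} → x ≢ i → x ≢ j → ext σ′ x ≡ ext σ x) × (∀ {π} → π ≤ᴮ σ′ → π ≤ᴮ σ)
ext-reduce {n} σ {i} {j} i<j lt = σ′ ,
  trans (cong (ext σ′) (sym iᶠ≡i)) (trans (ext-toℕ σ′ iᶠ)
    (trans (cong (toℕ ∘ (σ ⟨$⟩ʳ_)) firstᵗ) at-j)) ,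
  trans (cong (ext σ′) (sym jᶠ≡j)) (trans (ext-toℕ σ′ jᶠ)
    (trans (cong (toℕ ∘ (σ ⟨$⟩ʳ_)) secondᵗ) at-i)) ,
  (λ {x} → other x) ,
  reduce iᶠ jᶠ (subst₂ _<_ (sym iᶠ≡i) (sym jᶠ≡j) i<j) (subst₂ _<_ (sym at-j) (sym at-i) lt)
  where
  -- The inversion forces this: a position j beyond n holds the letter j, and all earlier positions
  -- hold smaller letters.
  j<n : j < n
  j<n = ≰⇒> λ n≤j → <-asym lt (subst (ext σ i <_) (sym (ext-≥ σ n≤j)) (small n≤j))
    where
    small : n ≤ j → ext σ i < j
    small n≤j with <-≤-connex i n
    ... | inj₂ n≤i = subst (_< j) (sym (ext-≥ σ n≤i)) i<j
    ... | inj₁ i<n = <-≤-trans (subst (_< n) (trans (sym (ext-toℕ σ _)) (cong (ext σ) (toℕ-fromℕ< i<n)))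
                       (toℕ<n (σ ⟨$⟩ʳ fromℕ< i<n))) n≤j
  i<n : i < n
  i<n = <-trans i<j j<n
  iᶠ = fromℕ< i<n
  jᶠ = fromℕ< j<n
  iᶠ≡i : toℕ iᶠ ≡ i
  iᶠ≡i = toℕ-fromℕ< i<n
  jᶠ≡j : toℕ jᶠ ≡ j
  jᶠ≡j = toℕ-fromℕ< j<n
  σ′ = transpose iᶠ jᶠ ∘ₚ σ
  at-i : toℕ (σ ⟨$⟩ʳ iᶠ) ≡ ext σ i
  at-i = trans (sym (ext-toℕ σ iᶠ)) (cong (ext σ) iᶠ≡i)
  at-j : toℕ (σ ⟨$⟩ʳ jᶠ) ≡ ext σ j
  at-j = trans (sym (ext-toℕ σ jᶠ)) (cong (ext σ) jᶠ≡j)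

  values : ∀ k → (k ≡ iᶠ → transpose iᶠ jᶠ ⟨$⟩ʳ k ≡ jᶠ) × (k ≡ jᶠ → transpose iᶠ jᶠ ⟨$⟩ʳ k ≡ iᶠ) ×
                 (k ≢ iᶠ → k ≢ jᶠ → transpose iᶠ jᶠ ⟨$⟩ʳ k ≡ k)
  values = transpose-elim
    (λ k l → (k ≡ iᶠ → l ≡ jᶠ) × (k ≡ jᶠ → l ≡ iᶠ) × (k ≢ iᶠ → k ≢ jᶠ → l ≡ k)) iᶠ jᶠ
    ((λ _ → refl) , (λ iᶠ≡jᶠ → sym iᶠ≡jᶠ) , λ ≢iᶠ → ⊥-elim (≢iᶠ refl))
    ((λ jᶠ≡iᶠ → sym jᶠ≡iᶠ) , (λ _ → refl) , λ _ ≢jᶠ → ⊥-elim (≢jᶠ refl))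
    (λ ≢iᶠ ≢jᶠ → (λ ≡iᶠ → ⊥-elim (≢iᶠ ≡iᶠ)) , (λ ≡jᶠ → ⊥-elim (≢jᶠ ≡jᶠ)) , λ _ _ → refl)
  firstᵗ : transpose iᶠ jᶠ ⟨$⟩ʳ iᶠ ≡ jᶠ
  firstᵗ = proj₁ (values iᶠ) refl
  secondᵗ : transpose iᶠ jᶠ ⟨$⟩ʳ jᶠ ≡ iᶠ
  secondᵗ = proj₁ (proj₂ (values jᶠ)) refl

  other : ∀ x → x ≢ i → x ≢ j → ext σ′ x ≡ ext σ x
  other = finOrBeyond n
    (λ k k≢i k≢j → trans (ext-toℕ σ′ k) (trans (cong (toℕ ∘ (σ ⟨$⟩ʳ_))
      (proj₂ (proj₂ (values k)) (λ k≡iᶠ → k≢i (trans (cong toℕ k≡iᶠ) iᶠ≡i))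
                                (λ k≡jᶠ → k≢j (trans (cong toℕ k≡jᶠ) jᶠ≡j))))
      (sym (ext-toℕ σ k))))
    (λ n≤x _ _ → trans (ext-≥ σ′ n≤x) (sym (ext-≥ σ n≤x)))

-- Reduce at (s 0 , s 1), then at (s 1 , s 2), and so on.
moveLargeRight : ∀ d {s : ℕ → ℕ} → (∀ {k l} → k < l → s k < s l) → (π σ : Permutation′ n) →
  (∀ {k} → k < d → ext σ (s (suc k)) < ext σ (s 0)) →
  (∀ {k} → k < d → ext π (s k) ≡ ext σ (s (suc k))) → ext π (s d) ≡ ext σ (s 0) →
  (∀ {x} → (∀ {k} → k ≤ d → x ≢ s k) → ext π x ≡ ext σ x) → π ≤ᴮ σ
moveLargeRight zero {s} s-mono π σ large shifted moved fixed = done (ext-≗⇒≈ π σ eq)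
  where
  eq : ext π ≗ ext σ
  eq x with x ≟ s 0
  ... | yes refl = moved
  ... | no  x≢   = fixed λ { z≤n → x≢ }
moveLargeRight (suc d) {s} s-mono π σ large shifted moved fixed
  with σ′ , σ′₀ , σ′₁ , σ′ₓ , lift ← ext-reduce σ (s-mono z<s) (large z<s)
  = lift (moveLargeRight d (s-mono ∘ s<s) π σ′
      (λ k<d → subst₂ _<_ (sym (σ′₂₊ _)) (sym σ′₁) (large (s<s k<d)))
      (λ k<d → trans (shifted (s<s k<d)) (sym (σ′₂₊ _)))
      (trans moved (sym σ′₁))
      fixed′)
  where
  σ′₂₊ : ∀ k → ext σ′ (s (2 + k)) ≡ ext σ (s (2 + k))
  σ′₂₊ k = σ′ₓ (>⇒≢ (s-mono z<s)) (>⇒≢ (s-mono (s<s z<s)))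

  fixed′ : ∀ {x} → (∀ {k} → k ≤ d → x ≢ s (suc k)) → ext π x ≡ ext σ′ x
  fixed′ {x} x≢ with x ≟ s 0
  ... | yes refl = trans (shifted z<s) (sym σ′₀)
  ... | no  x≢s₀ = trans (fixed λ { {zero} _ → x≢s₀ ; {suc k} (s≤s k≤d) → x≢ k≤d })
                         (sym (σ′ₓ x≢s₀ (x≢ z≤n)))

-- Reduce at (s 0 , i), then at (s 1 , i), and so on.
moveSmallLeft : ∀ d {s : ℕ → ℕ} {i} → (∀ {k l} → k < l → s k < s l) → s d < i →
  (π σ : Permutation′ n) →
  ext σ i < ext σ (s 0) → (∀ {k} → k < d → ext σ (s k) < ext σ (s (suc k))) →
  ext π (s 0) ≡ ext σ i → (∀ {k} → k < d → ext π (s (suc k)) ≡ ext σ (s k)) →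
  ext π i ≡ ext σ (s d) →
  (∀ {x} → (∀ {k} → k ≤ d → x ≢ s k) → x ≢ i → ext π x ≡ ext σ x) → π ≤ᴮ σ
moveSmallLeft zero {s} {i} s-mono sd<i π σ small incr moved shifted last fixed
  with σ′ , σ′₀ , σ′ᵢ , σ′ₓ , lift ← ext-reduce σ sd<i small
  = lift (done (ext-≗⇒≈ π σ′ eq))
  where
  eq : ext π ≗ ext σ′
  eq x with x ≟ s 0 | x ≟ i
  ... | yes refl | _        = trans moved (sym σ′₀)
  ... | no  _    | yes refl = trans last (sym σ′ᵢ)
  ... | no  x≢s₀ | no  x≢i  = trans (fixed (λ { z≤n → x≢s₀ }) x≢i) (sym (σ′ₓ x≢s₀ x≢i))
moveSmallLeft (suc d) {s} {i} s-mono sd<i π σ small incr moved shifted last fixed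
  with σ′ , σ′₀ , σ′ᵢ , σ′ₓ , lift ← ext-reduce σ (<-trans (s-mono z<s) sd<i) small =
  lift (moveSmallLeft d (s-mono ∘ s<s) sd<i π σ′
    -- Position `i` now holds the old letter of `s 0`, which is below the letter at `s 1`; so `s 1`
    -- and `i` form the next inversion.
    (subst₂ _<_ (sym σ′ᵢ) (sym (σ′₁₊ z≤n)) (incr z<s))
    (λ k<d → subst₂ _<_ (sym (σ′₁₊ (<⇒≤ k<d))) (sym (σ′₁₊ k<d)) (incr (s<s k<d)))
    (trans (shifted z<s) (sym σ′ᵢ))
    (λ k<d → trans (shifted (s<s k<d)) (sym (σ′₁₊ (<⇒≤ k<d))))
    (trans last (sym (σ′₁₊ ≤-refl)))
    fixed′)
  where
  s≤ : ∀ {k} → k ≤ d → s (suc k) ≤ s (suc d)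
  s≤ k≤d = [ (λ k<d → <⇒≤ (s-mono (s<s k<d))) , (λ { refl → ≤-refl }) ]′ (m≤n⇒m<n∨m≡n k≤d)

  σ′₁₊ : ∀ {k} → k ≤ d → ext σ′ (s (suc k)) ≡ ext σ (s (suc k))
  σ′₁₊ k≤d = σ′ₓ (>⇒≢ (s-mono z<s)) (<⇒≢ (≤-<-trans (s≤ k≤d) sd<i))

  fixed′ : ∀ {x} → (∀ {k} → k ≤ d → x ≢ s (suc k)) → x ≢ i → ext π x ≡ ext σ′ x
  fixed′ {x} x≢ x≢i with x ≟ s 0
  ... | yes refl = trans moved (sym σ′₀)
  ... | no  x≢s₀ = trans (fixed (λ { {zero} _ → x≢s₀ ; {suc k} (s≤s k≤d) → x≢ k≤d }) x≢i)
                         (sym (σ′ₓ x≢s₀ x≢i))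

module _ {p : ℕ} (π σ : Permutation′ n) where

  private
    f = ext π
    g = ext σ

    infixr 2 _⟨_⟩_
    _⟨_⟩_ : ∀ {a b c d : ℕ} → a ≡ b → b ≡ c → d ≡ c → a ≡ d
    e₁ ⟨ e₂ ⟩ e₃ = trans e₁ (trans e₂ (sym e₃))

    shift : ∀ (h : ℕ → ℕ) k → h (p + suc k) ≡ h (suc p + k)
    shift h k = cong h (+-suc p k)

  -- The first letter p of the lower block passes left over the whole upper block and becomes fixed.
  -- Its position ends in `+ 0` to agree with the `lower` region at zero.
  prefix-grows-lower : ∀ {q r} → Block (suc p) q (suc r) f → Block p (suc q) (suc r) g → π ≤ᴮ σ
  prefix-grows-lower {q} {r} B C = moveSmallLeft r {p +_} {p + (suc r + 0)} (+-monoʳ-< p)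
    (+-monoʳ-< p (m≤m+n (suc r) 0)) π σ
    (subst₂ _<_ (sym (C.lower z<s)) (sym (C.upper z<s)) (+-monoʳ-< p z<s))
    (λ {k} k<r → subst₂ _<_ (sym (C.upper (m<n⇒m<1+n k<r))) (sym (C.upper (s<s k<r)))
      (+-monoʳ-< p (+-monoʳ-< (suc q) (n<1+n k))))
    (B.prefix (s≤s (≤-reflexive (+-identityʳ p))) ⟨ refl ⟩ C.lower z<s)
    (λ {k} k<r → trans (shift f k) (B.upper (m<n⇒m<1+n k<r)) ⟨ sym (+-suc p _) ⟩ C.upper (m<n⇒m<1+n k<r))
    (trans (trans (cong (λ z → f (p + z)) (+-identityʳ (suc r))) (shift f r)) (B.upper (n<1+n r))
      ⟨ sym (+-suc p _) ⟩ C.upper (n<1+n r))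
    λ {x} → fixed (region p (suc q) (suc r) x)
    where
    module B = Block B
    module C = Block C
    fixed : ∀ {x} → Region p (suc q) (suc r) x → (∀ {k} → k ≤ r → x ≢ p + k) →
            x ≢ p + (suc r + 0) → f x ≡ g x
    fixed (prefix x<p)          x≢s x≢i = B.prefix (m<n⇒m<1+n x<p) ⟨ refl ⟩ C.prefix x<p
    fixed (upper (s≤s k≤r))     x≢s x≢i = ⊥-elim (x≢s k≤r refl)
    fixed (lower {zero}  _)     x≢s x≢i = ⊥-elim (x≢i refl)
    fixed (lower {suc k} (s≤s k<q)) x≢s x≢i =
      trans (trans (cong (λ z → f (p + z)) (+-suc (suc r) k)) (shift f _)) (B.lower k<q)
        ⟨ sym (+-suc p k) ⟩ C.lower (s<s k<q)
    fixed (suffix k)            x≢s x≢i =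
      trans (shift f _) (B.suffix k) ⟨ sym (+-suc p _) ⟩ C.suffix k

  -- The last letter p + q of the lower block goes to position p and the upper letters each move one
  -- place on; the largest of them jumps over the rest of the lower block to the vacated position,
  -- where it is fixed.
  suffix-grows-lower : ∀ {q r} → Block p q (suc r) f → Block p (suc q) (suc r) g → π ≤ᴮ σ
  suffix-grows-lower {q} {r} B C = moveSmallLeft r {p +_} {p + (suc r + q)} (+-monoʳ-< p)
    (+-monoʳ-< p (m≤m+n (suc r) q)) π σ
    (subst₂ _<_ (sym (C.lower (n<1+n q))) (sym (C.upper z<s)) (+-monoʳ-< p (m≤m+n (suc q) 0)))
    (λ {k} k<r → subst₂ _<_ (sym (C.upper (m<n⇒m<1+n k<r))) (sym (C.upper (s<s k<r)))
      (+-monoʳ-< p (+-monoʳ-< (suc q) (n<1+n k))))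
    (B.upper z<s ⟨ cong (p +_) (+-identityʳ q) ⟩ C.lower (n<1+n q))
    (λ {k} k<r → B.upper (s<s k<r) ⟨ cong (p +_) (+-suc q k) ⟩ C.upper (m<n⇒m<1+n k<r))
    (trans (cong f at-i) (B.suffix 0) ⟨ cong (p +_) (trans (cong (q +_) (+-identityʳ (suc r))) (+-suc q r)) ⟩
      C.upper (n<1+n r))
    λ {x} → fixed (region p (suc q) (suc r) x)
    where
    module B = Block B
    module C = Block C
    at-i : p + (suc r + q) ≡ p + (q + (suc r + 0))
    at-i = cong (p +_) (trans (+-comm (suc r) q) (cong (q +_) (sym (+-identityʳ (suc r)))))
    next : ∀ k → p + (suc q + (suc r + k)) ≡ p + (q + (suc r + suc k))
    next k = cong (p +_) (sym (trans (cong (q +_) (+-suc (suc r) k)) (+-suc q _)))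
    fixed : ∀ {x} → Region p (suc q) (suc r) x → (∀ {k} → k ≤ r → x ≢ p + k) →
            x ≢ p + (suc r + q) → f x ≡ g x
    fixed (prefix x<p)      x≢s x≢i = B.prefix x<p ⟨ refl ⟩ C.prefix x<p
    fixed (upper (s≤s k≤r)) x≢s x≢i = ⊥-elim (x≢s k≤r refl)
    fixed (lower {k} (s≤s k≤q)) x≢s x≢i with m≤n⇒m<n∨m≡n k≤q
    ... | inj₁ k<q  = B.lower k<q ⟨ refl ⟩ C.lower (s≤s k≤q)
    ... | inj₂ refl = ⊥-elim (x≢i refl)
    fixed (suffix k)        x≢s x≢i =
      trans (cong f (next k)) (B.suffix (suc k)) ⟨ sym (next k) ⟩ C.suffix k

  -- The last letter of the upper block passes right over the whole lower block and becomes fixed.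
  suffix-grows-upper : ∀ {q r} → Block p (suc q) r f → Block p (suc q) (suc r) g → π ≤ᴮ σ
  suffix-grows-upper {q} {r} B C = moveLargeRight (suc q) {s} (+-monoʳ-< p ∘ +-monoʳ-< r) π σ
    (λ {k} k≤q → subst₂ _<_ (sym (at-suc k≤q)) (sym at-0)
      (+-monoʳ-< p (<-≤-trans k≤q (m≤m+n (suc q) r))))
    (λ k≤q → B.lower k≤q ⟨ refl ⟩ at-suc k≤q)
    (trans (cong f at-d) (B.suffix 0) ⟨ cong (λ z → p + (suc q + z)) (+-identityʳ r) ⟩ at-0)
    λ {x} → fixed (region p (suc q) (suc r) x)
    where
    module B = Block B
    module C = Block C
    s : ℕ → ℕ
    s k = p + (r + k)
    at-0 : g (s 0) ≡ p + (suc q + r)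
    at-0 = trans (cong (λ z → g (p + z)) (+-identityʳ r)) (C.upper (n<1+n r))
    s-suc : ∀ k → p + (suc r + k) ≡ s (suc k)
    s-suc k = cong (p +_) (sym (+-suc r k))
    at-suc : ∀ {k} → k < suc q → g (s (suc k)) ≡ p + k
    at-suc k≤q = trans (cong g (sym (s-suc _))) (C.lower k≤q)
    at-d : s (suc q) ≡ p + (suc q + (r + 0))
    at-d = cong (p +_) (trans (+-comm r (suc q)) (cong (suc q +_) (sym (+-identityʳ r))))
    next : ∀ k → p + (suc q + (suc r + k)) ≡ p + (suc q + (r + suc k))
    next k = cong (λ z → p + (suc q + z)) (sym (+-suc r k))
    fixed : ∀ {x} → Region p (suc q) (suc r) x → (∀ {k} → k ≤ suc q → x ≢ s k) → f x ≡ g x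
    fixed (prefix x<p)          x≢s = B.prefix x<p ⟨ refl ⟩ C.prefix x<p
    fixed (upper {k} (s≤s k≤r)) x≢s with m≤n⇒m<n∨m≡n k≤r
    ... | inj₁ k<r  = B.upper k<r ⟨ refl ⟩ C.upper (s≤s k≤r)
    ... | inj₂ refl = ⊥-elim (x≢s z≤n (cong (p +_) (sym (+-identityʳ r))))
    fixed (lower {k} k≤q)       x≢s = ⊥-elim (x≢s k≤q (s-suc k))
    fixed (suffix k)            x≢s =
      trans (cong f (next k)) (B.suffix (suc k)) ⟨ sym (next k) ⟩ C.suffix k

  -- The first letter p + q + 1 of the upper block goes to the end of the lower block, whose letters
  -- each move one place back; the first of them jumps over the rest of the upper block to position
  -- p, where it is fixed. Hence `s` lists p and then the positions of the lower block.
  prefix-grows-upper : ∀ {q r} → Block (suc p) (suc q) r f → Block p (suc q) (suc r) g → π ≤ᴮ σ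
  prefix-grows-upper {q} {r} B C = moveLargeRight (suc q) {s} s-mono π σ
    (λ {k} k≤q → subst₂ _<_ (sym (C.lower k≤q)) (sym at-0) (+-monoʳ-< p k≤q))
    shifted
    (trans (shift f _) (B.lower (n<1+n q)) ⟨ sym (+-suc p q) ⟩ at-0)
    λ {x} → fixed (region p (suc q) (suc r) x)
    where
    module B = Block B
    module C = Block C
    s : ℕ → ℕ
    s zero    = p
    s (suc k) = p + (suc r + k)
    s-mono : ∀ {k l} → k < l → s k < s l
    s-mono {zero}  {suc l} _         = m<m+n p z<s
    s-mono {suc k} {suc l} (s≤s k<l) = +-monoʳ-< p (+-monoʳ-< (suc r) k<l)
    at-0 : g p ≡ p + suc q
    at-0 = trans (cong g (sym (+-identityʳ p)))
      (trans (C.upper z<s) (cong (p +_) (+-identityʳ (suc q))))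
    shifted : ∀ {k} → k < suc q → f (s k) ≡ g (s (suc k))
    shifted {zero}  _         = B.prefix (n<1+n p) ⟨ sym (+-identityʳ p) ⟩ C.lower z<s
    shifted {suc k} (s≤s k<q) =
      trans (shift f _) (B.lower (m<n⇒m<1+n k<q)) ⟨ sym (+-suc p k) ⟩ C.lower (s<s k<q)
    fixed : ∀ {x} → Region p (suc q) (suc r) x → (∀ {k} → k ≤ suc q → x ≢ s k) → f x ≡ g x
    fixed (prefix x<p)              x≢s = B.prefix (m<n⇒m<1+n x<p) ⟨ refl ⟩ C.prefix x<p
    fixed (upper {zero} _)          x≢s = ⊥-elim (x≢s z≤n (+-identityʳ p))
    fixed (upper {suc k} (s≤s k<r)) x≢s =
      trans (shift f k) (B.upper k<r)
        ⟨ sym (trans (cong (p +_) (+-suc (suc q) k)) (+-suc p _)) ⟩ C.upper (s<s k<r)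
    fixed (lower k≤q)               x≢s = ⊥-elim (x≢s k≤q refl)
    fixed (suffix k)                x≢s =
      trans (cong f (next k)) (B.suffix k) ⟨ sym (next k) ⟩ C.suffix k
      where
      next : ∀ k → p + (suc q + (suc r + k)) ≡ suc p + (suc q + (r + k))
      next k = trans (cong (p +_) (+-suc (suc q) (r + k))) (+-suc p _)

-- Unit moves generate the componentwise order

data _⋖_ : Code → Code → Set where
  prefix-lower : ∀ {p q r s} → (suc p ∷ q ∷ r ∷ s ∷ []) ⋖ (p ∷ suc q ∷ r ∷ s ∷ [])
  prefix-upper : ∀ {p q r s} → (suc p ∷ q ∷ r ∷ s ∷ []) ⋖ (p ∷ q ∷ suc r ∷ s ∷ [])
  suffix-lower : ∀ {p q r s} → (p ∷ q ∷ r ∷ suc s ∷ []) ⋖ (p ∷ suc q ∷ r ∷ s ∷ [])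
  suffix-upper : ∀ {p q r s} → (p ∷ q ∷ r ∷ suc s ∷ []) ⋖ (p ∷ q ∷ suc r ∷ s ∷ [])

⋖⇒≤ᴮ : ∀ {v w} → v ⋖ w → (π σ : Permutation′ n) → Encodes π v → Encodes σ w → π ≤ᴮ σ
⋖⇒≤ᴮ prefix-lower π σ (B , _) (C , _) = prefix-grows-lower π σ B C
⋖⇒≤ᴮ prefix-upper π σ (B , _) (C , _) = prefix-grows-upper π σ B C
⋖⇒≤ᴮ suffix-lower π σ (B , _) (C , _) = suffix-grows-lower π σ B C
⋖⇒≤ᴮ suffix-upper π σ (B , _) (C , _) = suffix-grows-upper π σ B C

⋖⇒sum-≡ : ∀ {v w} → v ⋖ w → sum v ≡ sum w
⋖⇒sum-≡ (prefix-lower {p}) = sym (+-suc p _)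
⋖⇒sum-≡ (prefix-upper {p} {q}) = sym (trans (cong (p +_) (+-suc q _)) (+-suc p _))
⋖⇒sum-≡ (suffix-lower {p} {q} {r}) = cong (p +_) (trans (cong (q +_) (+-suc r _)) (+-suc q _))
⋖⇒sum-≡ (suffix-upper {p} {q} {r}) = cong (λ z → p + (q + z)) (+-suc r _)

encoded : ∀ v → 2 + sum v ≡ n → ∃ λ (π : Permutation′ n) → Encodes π v
encoded {n} (p ∷ q ∷ r ∷ s ∷ []) eq = _ , blockPermutation-Block p (suc q) (suc r) c≤n , eq
  where
  c≤n : p + (suc q + suc r) ≤ n
  c≤n = ≤-trans (m≤m+n _ s) (≤-reflexive (Encodes-size {p = p} {q} {r} eq))

Encodes⇒sum-≡ : {π : Permutation′ n} → ∀ {v} → Encodes π v → 2 + sum v ≡ n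
Encodes⇒sum-≡ {v = _ ∷ _ ∷ _ ∷ _ ∷ []} = proj₂

Encodes-functional : {π σ : Permutation′ n} → ∀ {v} → Encodes π v → Encodes σ v → π ≈ σ
Encodes-functional {π = π} {σ} {_ ∷ _ ∷ _ ∷ _ ∷ []} (B , _) (C , _) = ext-≗⇒≈ π σ (Block-unique B C)

-- Moves preserve the sum, so every intermediate code is again the code of a permutation of the same
-- size, through which the Bruhat relations compose.
⋖*⇒≤ᴮ : ∀ {v w} → Star _⋖_ v w → (π σ : Permutation′ n) → Encodes π v → Encodes σ w → π ≤ᴮ σ
⋖*⇒≤ᴮ {v = v} ε π σ eπ eσ = done (Encodes-functional {π = π} {σ} {v} eπ eσ)
⋖*⇒≤ᴮ {v = v} (_◅_ {j = u} v⋖u u⋖*w) π σ eπ eσ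
  with ρ , eρ ← encoded u (trans (cong (2 +_) (sym (⋖⇒sum-≡ v⋖u))) (Encodes⇒sum-≡ {π = π} {v} eπ))
  = ≤ᴮ-trans (⋖⇒≤ᴮ v⋖u π ρ eπ eρ) (⋖*⇒≤ᴮ u⋖*w ρ σ eρ eσ)

-- Any matching of units leaving the ends with units entering the blocks would do, because all four
-- combinations are moves; this one exhausts x before y and z before t.
path : ∀ {p q r s} x y z t → x + y ≡ z + t →
       Star _⋖_ (x + p ∷ q ∷ r ∷ y + s ∷ []) (p ∷ z + q ∷ t + r ∷ s ∷ [])
path zero    zero    zero    zero    _  = ε
path {p} {q} {r} {s} (suc x) y (suc z) t eq = prefix-lower ◅
  subst (λ q′ → Star _⋖_ (x + p ∷ suc q ∷ r ∷ y + s ∷ []) (p ∷ q′ ∷ t + r ∷ s ∷ [])) (+-suc z q)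
    (path x y z t (suc-injective eq))
path {p} {q} {r} {s} (suc x) y zero (suc t) eq = prefix-upper ◅
  subst (λ r′ → Star _⋖_ (x + p ∷ q ∷ suc r ∷ y + s ∷ []) (p ∷ q ∷ r′ ∷ s ∷ [])) (+-suc t r)
    (path x y zero t (suc-injective eq))
path {p} {q} {r} {s} zero (suc y) (suc z) t eq = suffix-lower ◅
  subst (λ q′ → Star _⋖_ (p ∷ suc q ∷ r ∷ y + s ∷ []) (p ∷ q′ ∷ t + r ∷ s ∷ [])) (+-suc z q)
    (path zero y z t (suc-injective eq))
path {p} {q} {r} {s} zero (suc y) zero (suc t) eq = suffix-upper ◅
  subst (λ r′ → Star _⋖_ (p ∷ q ∷ suc r ∷ y + s ∷ []) (p ∷ q ∷ r′ ∷ s ∷ [])) (+-suc t r)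
    (path zero y zero t (suc-injective eq))

≼⇒⋖* : ∀ {v w} → sum v ≡ sum w → v ≼ w → Star _⋖_ v w
≼⇒⋖* {p₁ ∷ q ∷ r ∷ s₁ ∷ []} {p ∷ q₁ ∷ r₁ ∷ s ∷ []} eq ((p≤ , s≤) , q≤ , r≤)
  with x , refl ← m≤n⇒∃[o]m+o≡n p≤ | y , refl ← m≤n⇒∃[o]m+o≡n s≤
     | z , refl ← m≤n⇒∃[o]m+o≡n q≤ | t , refl ← m≤n⇒∃[o]m+o≡n r≤
  rewrite +-comm p x | +-comm s y | +-comm q z | +-comm r t
  = path x y z t (+-cancelˡ-≡ (p + q + r + s) _ _
      (trans (sym (sumˡ p q r s x y)) (trans eq (sumʳ p q r s z t))))
  where
  sumˡ : ∀ p q r s x y → x + p + (q + (r + (y + s + 0))) ≡ p + q + r + s + (x + y)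
  sumˡ = solve-∀
  sumʳ : ∀ p q r s z t → p + (z + q + (t + r + (s + 0))) ≡ p + q + r + s + (z + t)
  sumʳ = solve-∀

≼⇒≤ᴮ : {π σ : Permutation′ n} → ∀ {v w} → Encodes π v → Encodes σ w → v ≼ w → π ≤ᴮ σ
≼⇒≤ᴮ {π = π} {σ} {v} {w} eπ eσ v≼w = ⋖*⇒≤ᴮ (≼⇒⋖* {v} {w} (+-cancelˡ-≡ 2 _ _
  (trans (Encodes⇒sum-≡ {π = π} {v} eπ) (sym (Encodes⇒sum-≡ {π = σ} {w} eσ)))) v≼w) π σ eπ eσ

-- Probabilities

Encodes-injective : {π σ : Permutation′ n} → ∀ {v w} → Encodes π v → Encodes σ w → π ≈ σ → v ≡ w
Encodes-injective {π = π} {σ} {v} {w} eπ eσ π≈σ = ≼-antisym v w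
  (≤ᴮ⇒≼ {π = π} {σ} {v} {w} eπ eσ (done π≈σ))
  (≤ᴮ⇒≼ {π = σ} {π} {w} {v} eσ eπ (done (sym ∘ π≈σ)))

bigrassmannian⇒encodes : {π : Permutation′ n} → Bigrassmannian π → ∃ (Encodes π)
bigrassmannian⇒encodes {n} {π} bi with p , q , r , B , c≤n ← bigrassmannian⇒Block π bi
  with s , eq ← m≤n⇒∃[o]m+o≡n c≤n
  = (p ∷ q ∷ r ∷ s ∷ []) , B , trans (size p q r s) eq
  where
  size : ∀ p q r s → 2 + (p + (q + (r + (s + 0)))) ≡ p + (suc q + suc r) + s
  size = solve-∀

encodes⇒bigrassmannian : {π : Permutation′ n} → ∀ {v} → Encodes π v → Bigrassmannian π
encodes⇒bigrassmannian {π = π} {p ∷ q ∷ r ∷ s ∷ []} (B , eq) = Block⇒bigrassmannian π B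
  (≤-trans (m≤m+n _ s) (≤-reflexive (Encodes-size {p = p} {q} {r} eq)))

∈-𝔅⁺ : {π : Permutation′ n} → ∀ {v} → Encodes π v → π ∈≈ 𝔅 n
∈-𝔅⁺ {n} {π} {v} e = Membershipₚ.∈-filter⁺ (𝔖-setoid n) bigrassmannian?
  (λ {π} {ρ} → bigrassmannian-resp {π = π} {ρ}) {v = π}
  (𝔖-complete π) (encodes⇒bigrassmannian {π = π} {v} e)

∈-𝔅⁻ : {π : Permutation′ n} → π ∈≈ 𝔅 n → ∃ (Encodes π)
∈-𝔅⁻ {n} {π} π∈ = bigrassmannian⇒encodes {π = π}
  (proj₂ (Membershipₚ.∈-filter⁻ (𝔖-setoid n) bigrassmannian?
    (λ {π} {ρ} → bigrassmannian-resp {π = π} {ρ}) {v = π} {xs = 𝔖 n} π∈))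

𝔅-! : ∀ n → Unique≈ (𝔅 n)
𝔅-! n = Uniqueₚ.filter⁺ (𝔖-setoid n) bigrassmannian? (𝔖-unique n)

sum-code : ∀ {m} {π : Permutation′ (2 + m)} {v} → Encodes π v → sum v ≡ m
sum-code {π = π} {v} e = +-cancelˡ-≡ 2 _ _ (Encodes⇒sum-≡ {π = π} {v} e)

-- The right side is C(m + 3 , 3), that is C(n + 1 , 3) for n = m + 2.
𝔟≡#comp : ∀ m → 𝔟 (2 + m) ≡ #comp 4 m
𝔟≡#comp m = length-≡ (𝔖-setoid (2 + m)) (setoid Code) Encodes (𝔅-! (2 + m)) (compositions-! 4 m)
  (λ {π} π∈ → let v , e = ∈-𝔅⁻ {π = π} π∈ in
    v , ∈-compositions⁺ v (sum-code {π = π} {v} e) , e)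
  (λ {v} v∈ → let π , e = encoded v (cong (2 +_) (∈-compositions⁻ 4 m v∈)) in
    π , ∈-𝔅⁺ {π = π} {v} e , e)
  (λ { {π} {ρ} {v} eπ eρ refl → Encodes-functional {π = π} {ρ} {v} eπ eρ })
  (λ {π} {ρ} {v} {w} → Encodes-injective {π = π} {ρ} {v} {w})

module _ (m : ℕ) {Q : Pred (Permutation′ (2 + m) × Permutation′ (2 + m)) 0ℓ} (Q? : Decidable Q)
  (Q-resp : ∀ {π π′ σ σ′} → π ≈ π′ → σ ≈ σ′ → Q (π , σ) → Q (π′ , σ′))
  {vws : List (Code × Code)} (vws! : Unique vws)
  (sums : ∀ {v w} → (v , w) ∈ vws → sum v ≡ m × sum w ≡ m)
  (to   : ∀ {π σ v w} → Encodes π v → Encodes σ w → Q (π , σ) → (v , w) ∈ vws)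
  (from : ∀ {π σ v w} → Encodes π v → Encodes σ w → (v , w) ∈ vws → Q (π , σ))
  where

  private
    S = 𝔖-setoid (2 + m)

  -- `Q` is abstract because three predicates are counted through codes: the Bruhat order, its
  -- converse and their conjunction.
  length-filter-𝔅² : length (filter Q? (𝔅² (2 + m))) ≡ length vws
  length-filter-𝔅² = length-≡ (S ×ₛ S) (setoid (Code × Code))
    (λ (π , σ) (v , w) → Encodes π v × Encodes σ w)
    (Uniqueₚ.filter⁺ (S ×ₛ S) Q? (Uniqueₚ.cartesianProduct⁺ S S (𝔅-! _) (𝔅-! _)))
    vws!
    (λ {πσ} πσ∈ →
      let π , σ = πσ
          πσ∈² , Qπσ = Membershipₚ.∈-filter⁻ (S ×ₛ S) Q? Q-resp′ {v = πσ} {xs = 𝔅² (2 + m)} πσ∈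
          π∈ , σ∈ = Membershipₚ.∈-cartesianProduct⁻ S S (𝔅 _) (𝔅 _) {πσ} πσ∈²
          v , eπ = ∈-𝔅⁻ {π = π} π∈
          w , eσ = ∈-𝔅⁻ {π = σ} σ∈
      in (v , w) , to {π} {σ} {v} {w} eπ eσ Qπσ , eπ , eσ)
    (λ {vw} vw∈ →
      let v , w = vw
          sum-v , sum-w = sums vw∈
          π , eπ = encoded v (cong (2 +_) sum-v)
          σ , eσ = encoded w (cong (2 +_) sum-w)
      in (π , σ) ,
         Membershipₚ.∈-filter⁺ (S ×ₛ S) Q? Q-resp′ {v = π , σ}
           (Membershipₚ.∈-cartesianProduct⁺ S S {π} {σ}
             (∈-𝔅⁺ {π = π} {v} eπ) (∈-𝔅⁺ {π = σ} {w} eσ))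
           (from {π} {σ} {v} {w} eπ eσ vw∈) ,
         eπ , eσ)
    (λ { {π , σ} {π′ , σ′} {v , w} (eπ , eσ) (eπ′ , eσ′) refl →
      Encodes-functional {π = π} {π′} {v} eπ eπ′ , Encodes-functional {π = σ} {σ′} {w} eσ eσ′ })
    (λ { {π , σ} {π′ , σ′} {v , w} {v′ , w′} (eπ , eσ) (eπ′ , eσ′) (π≈π′ , σ≈σ′) →
      cong₂ _,_ (Encodes-injective {π = π} {π′} {v} {v′} eπ eπ′ π≈π′)
                (Encodes-injective {π = σ} {σ′} {w} {w′} eσ eσ′ σ≈σ′) })
    where
    Q-resp′ : ∀ {πσ πσ′} → _ → Q πσ → Q πσ′
    Q-resp′ {π , σ} {π′ , σ′} (π≈π′ , σ≈σ′) = Q-resp {π} {π′} {σ} {σ′} π≈π′ σ≈σ′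

≤ᴮ-resp-≈ : {π π′ σ σ′ : Permutation′ n} → π ≈ π′ → σ ≈ σ′ → π ≤ᴮ σ → π′ ≤ᴮ σ′
≤ᴮ-resp-≈ {σ = σ} {σ′} π≈π′ σ≈σ′ π≤σ = ≤ᴮ-trans (done (sym ∘ π≈π′)) (≤ᴮ-respʳ-≈ {σ = σ} {σ′} σ≈σ′ π≤σ)

module _ (m : ℕ) where

  private
    _≥ᴮ?_ = λ (π σ : Permutation′ (2 + m)) → σ ≤ᴮ? π

  #≤ᴮ : length (filter (uncurry _≤ᴮ?_) (𝔅² (2 + m))) ≡ length (intervals m)
  #≤ᴮ = length-filter-𝔅² m (uncurry _≤ᴮ?_)
    (λ {π} {π′} {σ} {σ′} → ≤ᴮ-resp-≈ {π = π} {π′} {σ} {σ′})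
    (intervals-! m) (proj₁ ∘ ∈-intervals⁻ m)
    (λ {π} {σ} {v} {w} eπ eσ π≤σ → ∈-intervals⁺ m (sum-code {π = π} {v} eπ) (sum-code {π = σ} {w} eσ)
      (≤ᴮ⇒≼ {π = π} {σ} {v} {w} eπ eσ π≤σ))
    (λ {π} {σ} {v} {w} eπ eσ vw∈ → ≼⇒≤ᴮ {π = π} {σ} {v} {w} eπ eσ (proj₂ (∈-intervals⁻ m vw∈)))

  #≥ᴮ : length (filter (uncurry _≥ᴮ?_) (𝔅² (2 + m))) ≡ length (intervals m)
  #≥ᴮ = trans (length-filter-𝔅² m (uncurry _≥ᴮ?_)
    (λ {π} {π′} {σ} {σ′} π≈π′ σ≈σ′ → ≤ᴮ-resp-≈ {π = σ} {σ′} {π} {π′} σ≈σ′ π≈π′)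
    (Unique.map⁺ (cong swap) (intervals-! m))
    (λ vw∈ → swap (proj₁ (∈-intervals⁻ m (unswap vw∈))))
    (λ {π} {σ} {v} {w} eπ eσ σ≤π → ∈.∈-map⁺ swap
      (∈-intervals⁺ m (sum-code {π = σ} {w} eσ) (sum-code {π = π} {v} eπ)
        (≤ᴮ⇒≼ {π = σ} {π} {w} {v} eσ eπ σ≤π)))
    (λ {π} {σ} {v} {w} eπ eσ vw∈ → ≼⇒≤ᴮ {π = σ} {π} {w} {v} eσ eπ
      (proj₂ (∈-intervals⁻ m (unswap vw∈)))))
    (length-map swap (intervals m))
    where
    unswap : ∀ {v w : Code} → (v , w) ∈ map swap (intervals m) → (w , v) ∈ intervals m
    unswap vw∈ with _ , wv∈ , refl ← ∈.∈-map⁻ swap vw∈ = wv∈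

  #≤ᴮ∩≥ᴮ : length (filter (uncurry _≤ᴮ?_ ∩? uncurry _≥ᴮ?_) (𝔅² (2 + m))) ≡ #comp 4 m
  #≤ᴮ∩≥ᴮ = trans (length-filter-𝔅² m (uncurry _≤ᴮ?_ ∩? uncurry _≥ᴮ?_)
    (λ {π} {π′} {σ} {σ′} π≈π′ σ≈σ′ (π≤σ , σ≤π) →
      ≤ᴮ-resp-≈ {π = π} {π′} {σ} {σ′} π≈π′ σ≈σ′ π≤σ , ≤ᴮ-resp-≈ {π = σ} {σ′} {π} {π′} σ≈σ′ π≈π′ σ≤π)
    (Unique.map⁺ (cong proj₁) (compositions-! 4 m))
    (λ vw∈ → let _ , v∈ , eq = ∈.∈-map⁻ diagonal vw∈ in sums v∈ eq)
    (λ {π} {σ} {v} {w} eπ eσ (π≤σ , σ≤π) → diagonal∈ (sum-code {π = π} {v} eπ) (≼-antisym v w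
      (≤ᴮ⇒≼ {π = π} {σ} {v} {w} eπ eσ π≤σ) (≤ᴮ⇒≼ {π = σ} {π} {w} {v} eσ eπ σ≤π)))
    (λ {π} {σ} {v} {w} eπ eσ vw∈ → let _ , _ , eq = ∈.∈-map⁻ diagonal vw∈ in
      from-equal {π} {σ} {v} {w} eπ eσ (trans (cong proj₁ eq) (sym (cong proj₂ eq)))))
    (length-map diagonal (compositions 4 m))
    where
    diagonal : Code → Code × Code
    diagonal v = v , v
    sums : ∀ {u v w : Code} → u ∈ compositions 4 m → (v , w) ≡ diagonal u → sum v ≡ m × sum w ≡ m
    sums u∈ refl = ∈-compositions⁻ 4 m u∈ , ∈-compositions⁻ 4 m u∈
    diagonal∈ : ∀ {v w : Code} → sum v ≡ m → v ≡ w → (v , w) ∈ map diagonal (compositions 4 m)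
    diagonal∈ {v} sum-v refl = ∈.∈-map⁺ diagonal (∈-compositions⁺ v sum-v)
    from-equal : ∀ {π σ : Permutation′ (2 + m)} {v w} → Encodes π v → Encodes σ w → v ≡ w →
            π ≤ᴮ σ × σ ≤ᴮ π
    from-equal {π} {σ} {v} eπ eσ refl =
      ≼⇒≤ᴮ {π = π} {σ} {v} {v} eπ eσ (≼-refl v) , ≼⇒≤ᴮ {π = σ} {π} {v} {v} eσ eπ (≼-refl v)

  #comparable : length (filter (uncurry comparable?) (𝔅² (2 + m))) + 𝔟 (2 + m) ≡
                2 * length (intervals m)
  #comparable = begin
    length (filter (uncurry comparable?) (𝔅² (2 + m))) + 𝔟 (2 + m)
      ≡⟨ cong (length (filter (uncurry comparable?) (𝔅² (2 + m))) +_)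
            (trans (𝔟≡#comp m) (sym #≤ᴮ∩≥ᴮ)) ⟩
    length (filter (uncurry comparable?) (𝔅² (2 + m))) +
    length (filter (uncurry _≤ᴮ?_ ∩? uncurry _≥ᴮ?_) (𝔅² (2 + m)))
      -- `uncurry comparable?` is by definition the union of the two tests, so this is inclusion and
      -- exclusion.
      ≡⟨ length-filter-∪ (uncurry _≤ᴮ?_) (uncurry _≥ᴮ?_) (𝔅² (2 + m)) ⟩
    length (filter (uncurry _≤ᴮ?_) (𝔅² (2 + m))) + length (filter (uncurry _≥ᴮ?_) (𝔅² (2 + m)))
      ≡⟨ cong₂ _+_ #≤ᴮ (trans #≥ᴮ (sym (+-identityʳ _))) ⟩
    2 * length (intervals m) ∎
    where open ≡-Reasoning

  #intervals-𝔟 : 10 * length (intervals m) ≡ 𝔟 (2 + m) * 𝔟 (2 + m + 2)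
  #intervals-𝔟 = begin
    10 * length (intervals m)       ≡⟨ #intervals m ⟩
    #comp 4 m * #comp 4 (2 + m)     ≡⟨ cong (λ k → #comp 4 m * #comp 4 k) (+-comm 2 m) ⟩
    #comp 4 m * #comp 4 (m + 2)     ≡⟨ cong₂ _*_ (𝔟≡#comp m) (𝔟≡#comp (m + 2)) ⟨
    𝔟 (2 + m) * 𝔟 (2 + m + 2)       ∎
    where open ≡-Reasoning

-- From counts to probabilities

open import Data.Integer.Base as ℤ using (+_; _-_)

-- `_/_` reduces to lowest terms; equality is easier to obtain for unnormalised fractions, where it
-- is cross-multiplication, and normalisation respects it.
/-≡ : ∀ i j m n .{{_ : NonZero m}} .{{_ : NonZero n}} → i ℤ.* + n ≡ j ℤ.* + m → i / m ≡ j / n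
/-≡ i j (suc m) (suc n) eq = fromℚᵘ-cong {mkℚᵘ i m} {mkℚᵘ j n} (*≡* eq)

theorem1p5 : (n : ℕ) → .{{_ : NonTrivial n}} →
    p₂ n ≡ ((+ 𝔟 (n + 2) - + 5) / (5 * 𝔟 n)) {{k*𝔟-nonZero 5 n}} ×
    p₂≤ n ≡ (+ 𝔟 (n + 2) / (10 * 𝔟 n)) {{k*𝔟-nonZero 10 n}}
theorem1p5 n@(suc (suc m)) =
  /-≡ (+ c) (+ b′ - + 5) (length (𝔅² n)) (5 * b)
    {{𝔅²-nonZero n}} {{k*𝔟-nonZero 5 n}} comparable-eq ,
  /-≡ (+ l) (+ b′) (length (𝔅² n)) (10 * b)
    {{𝔅²-nonZero n}} {{k*𝔟-nonZero 10 n}} ≤-eq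
  where
  b  = 𝔟 n
  b′ = 𝔟 (n + 2)
  N  = length (intervals m)
  c  = length (filter (uncurry comparable?) (𝔅² n))
  l  = length (filter (uncurry _≤ᴮ?_) (𝔅² n))
  open ≡-Reasoning

  𝔅²-length : length (𝔅² n) ≡ b * b
  𝔅²-length = length-cartesianProduct (𝔅 n) (𝔅 n)

  ≤-eqℕ : l * (10 * b) ≡ b′ * length (𝔅² n)
  ≤-eqℕ = begin
    l * (10 * b)         ≡⟨ cong (_* (10 * b)) (#≤ᴮ m) ⟩
    N * (10 * b)         ≡⟨ regroup N b ⟩
    10 * N * b           ≡⟨ cong (_* b) (#intervals-𝔟 m) ⟩
    b * b′ * b           ≡⟨ rotate b b′ ⟩
    b′ * (b * b)         ≡⟨ cong (b′ *_) 𝔅²-length ⟨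
    b′ * length (𝔅² n)   ∎
    where
    regroup : ∀ x y → x * (10 * y) ≡ 10 * x * y
    regroup = solve-∀
    rotate : ∀ x y → x * y * x ≡ y * (x * x)
    rotate = solve-∀

  ≤-eq : + l ℤ.* + (10 * b) ≡ + b′ ℤ.* + length (𝔅² n)
  ≤-eq = trans (sym (ℤ.pos-* l (10 * b))) (trans (cong (λ k → + k) ≤-eqℕ) (ℤ.pos-* b′ (length (𝔅² n))))

  -- The 5 that is subtracted in the numerator is kept on the left to stay within ℕ. It is the
  -- diagonal: with `length (𝔅² n)` equal to `b * b`, the left side becomes `(c + b) * (5 * b)`, and
  -- c + b = 2 N.
  comparable-eqℕ : c * (5 * b) + 5 * length (𝔅² n) ≡ b′ * length (𝔅² n)
  comparable-eqℕ = begin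
    c * (5 * b) + 5 * length (𝔅² n) ≡⟨ cong (λ x → c * (5 * b) + 5 * x) 𝔅²-length ⟩
    c * (5 * b) + 5 * (b * b)       ≡⟨ collect c b ⟩
    (c + b) * (5 * b)               ≡⟨ cong (_* (5 * b)) (#comparable m) ⟩
    2 * N * (5 * b)                 ≡⟨ regroup N b ⟩
    N * (10 * b)                    ≡⟨ cong (_* (10 * b)) (#≤ᴮ m) ⟨
    l * (10 * b)                    ≡⟨ ≤-eqℕ ⟩
    b′ * length (𝔅² n)              ∎
    where
    collect : ∀ x y → x * (5 * y) + 5 * (y * y) ≡ (x + y) * (5 * y)
    collect = solve-∀
    regroup : ∀ x y → 2 * x * (5 * y) ≡ x * (10 * y)
    regroup = solve-∀

  comparable-eq : + c ℤ.* + (5 * b) ≡ (+ b′ - + 5) ℤ.* + length (𝔅² n)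
  comparable-eq = begin
    + c ℤ.* + (5 * b)             ≡⟨ cancel (+ c ℤ.* + (5 * b)) (+ 5) L ⟩
    + c ℤ.* + (5 * b) ℤ.+ + 5 ℤ.* L - + 5 ℤ.* L
      ≡⟨ cong (_- + 5 ℤ.* L) (cong₂ ℤ._+_ (ℤ.pos-* c (5 * b)) (ℤ.pos-* 5 (length (𝔅² n)))) ⟨
    + (c * (5 * b) + 5 * length (𝔅² n)) - + 5 ℤ.* L
      ≡⟨ cong (λ x → + x - + 5 ℤ.* L) comparable-eqℕ ⟩
    + (b′ * length (𝔅² n)) - + 5 ℤ.* L
      ≡⟨ cong (_- + 5 ℤ.* L) (ℤ.pos-* b′ (length (𝔅² n))) ⟩
    + b′ ℤ.* L - + 5 ℤ.* L        ≡⟨ factor (+ b′) (+ 5) L ⟩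
    (+ b′ - + 5) ℤ.* L            ∎
    where
    L = + length (𝔅² n)
    cancel : ∀ x y z → x ≡ x ℤ.+ y ℤ.* z - y ℤ.* z
    cancel = ℤ.solve-∀
    factor : ∀ x y z → x ℤ.* z - y ℤ.* z ≡ (x - y) ℤ.* z
    factor = ℤ.solve-∀
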